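{- Let $p$ be an odd prime and $A\in\mathbb{Z}$, and let $$T_p(1,-A,-1)=\prod_{\substack{i,j=1\\ p\nmid i^2-Aij-j^2}}^{(p-1)/2}(i^2-Aij-j^2).$$ (i) Suppose $p\mid A^2+4$. Then $p\equiv1\pmod4$, $A/2\equiv(-1)^k\left(\frac{p-1}{2}\right)!\pmod p$ for some $k\in\{0,1\}$, and $$T_p(1,-A,-1)\equiv\begin{cases}(-1)^{(p+7)/8}\left(\frac{p-1}{2}\right)!\pmod p&\text{if }p\equiv1\pmod8,\\ (-1)^{k+(p-5)/8}\pmod p&\text{if }p\equiv5\pmod8.\end{cases}$$ (ii) If $\left(\frac{A^2+4}{p}\right)=1$, then $$T_p(1,-A,-1)\equiv\begin{cases}-(A^2+4)^{(p-1)/4}\pmod p&\text{if }p\equiv1\pmod4,\\ -(A^2+4)^{(p+1)/4}u_{(p-1)/2}(A)/2\pmod p&\text{if }p\equiv3\pmod4.\end{cases}$$ (iii) If $\left(\frac{A^2+4}{p}\right)=-1$, then $$T_p(1,-A,-1)\equiv\begin{cases}(-A^2-4)^{(p-1)/4}\pmod p&\text{if }p\equiv1\pmod4,\\ (-A^2-4)^{(p+1)/4}u_{(p+1)/2}(A)/2\pmod p&\text{if }p\equiv3\pmod4.\end{cases}$$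
   Context: $\left(\frac{\cdot}{p}\right)$ is the Legendre symbol. The Lucas sequence $u_n(A)$ is defined by $u_0(A)=0$, $u_1(A)=1$, $u_{n+1}(A)=Au_n(A)+u_{n-1}(A)$ for $n\ge1$. Division by $2$ in a congruence modulo the odd prime $p$ means multiplication by the inverse of $2$ modulo $p$. -}

module Defs where

open import Data.Nat as ℕ using (ℕ; zero; suc)

open import Data.Nat.Divisibility using (_∣?_)
open import Data.Integer using (ℤ; +_; _-_; _*_; -_; ∣_∣; 1ℤ; 0ℤ)
open import Data.Integer.Divisibility as ℤD using ()
open import Data.List using (List; []; _∷_; map; concatMap; filter; foldr)
open import Data.Bool.ListAction using (any)
open import Data.Bool using (Bool; true; false; if_then_else_; not)
open import Relation.Nullary.Decidable using (does; ¬?)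

infix 4 _≡_[mod_]
_≡_[mod_] : ℤ → ℤ → ℕ → Set
a ≡ b [mod m ] = (+ m) ℤD.∣ (a - b)

divides? : ℕ → ℤ → Bool
divides? m a = does (m ∣? ∣ a ∣)

range1 : ℕ → List ℕ
range1 zero = []
range1 (suc n) = range1 n Data.List.++ (suc n ∷ [])

range0 : ℕ → List ℕ
range0 zero = []
range0 (suc n) = range0 n Data.List.++ (n ∷ [])

legendre : ℤ → ℕ → ℤ
legendre a p =
  if divides? p a then 0ℤ
  else (if any (λ x → divides? p ((+ x) * (+ x) - a)) (range0 p) then 1ℤ else - 1ℤ)

u : ℕ → ℤ → ℤ
u zero A = 0ℤ
u (suc zero) A = 1ℤ
u (suc (suc n)) A = A * u (suc n) A Data.Integer.+ u n A

form : ℤ → ℕ → ℕ → ℤ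
form A i j = (+ i) * (+ i) - A * (+ i) * (+ j) - (+ j) * (+ j)

T : ℕ → ℤ → ℤ
T p A = foldr _*_ 1ℤ (filter (λ x → ¬? (p ∣? ∣ x ∣)) vals)
  where
    h = (p ℕ.∸ 1) ℕ./ 2
    vals = concatMap (λ i → map (λ j → form A i j) (range1 h)) (range1 h)

-- inverse of 2 modulo an odd p, namely (p+1)/2
inv2 : ℕ → ℤ
inv2 p = + ((suc p) ℕ./ 2)

halfFact : ℕ → ℤ
halfFact p = + (((p ℕ.∸ 1) ℕ./ 2) ℕ.!)

-- Write h = (p − 1)/2 and group the factors f(i,j) = i² − Aij − j² by the class s of ± j/i in {1,…,h}.
-- The classes s and s* (of 1/s) are paired: f(i,j) f(j,i) = (A² + 4) i²j² − (i² + j²)² depends only on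
-- squares, so by Wilson the product of the two groups is the h-th power of A² + 2 − s² − s*².  If α, β
-- are the roots of z² = Az + 1, this number is (α + s²β)(α + s*²β), and the self-paired classes s² = ±1
-- contribute −(α + s²β)^h as well.  Hence, up to the vanishing factors, T ≡ (−1)^h (∏_s (α + s²β))^h.
--
-- If A² + 4 is a nonzero square, or zero, then α is in 𝔽_p and exactly one factor α + s²β vanishes; the
-- product of the others follows from ∏_{t=2}^{h} (1 − t²) ≡ −1/2.  If A² + 4 is a nonresidue, compute in
-- 𝔽_p[α]: from ∏_s (X − s²) = X^h − 1 and α^p = β the product is γ (α − β) with γ = α^(h+1), γ² = −1.
-- The Frobenius identity α^p = β comes from X^p − X = ∏_c (X − c), whose factors are permuted by X ↦ X + 1.
module Submission where

open import Defs
open import Algebra.Bundles using (CommutativeMonoid; CommutativeRing)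
import Algebra.Properties.CommutativeMonoid.Sum as Sum
import Algebra.Solver.CommutativeMonoid as CMSolver
import Algebra.Solver.Ring as RingSolver
open import Algebra.Solver.Ring.AlmostCommutativeRing using (_-Raw-AlmostCommutative⟶_; fromCommutativeRing)
open import Data.Bool using (Bool; true; false; if_then_else_)
open import Data.Bool.ListAction using (any)
open import Data.Empty using (⊥-elim)
open import Data.Fin as Fin using (Fin; zero; suc; toℕ; fromℕ<; _<?_; _≟_)
open import Data.Fin.Permutation using (permutation)
import Data.Fin.Properties as Finₚ
open import Data.Integer as ℤ using (ℤ; +_; 0ℤ; 1ℤ; ∣_∣)
open import Data.Integer.Divisibility as ℤD using ()
open import Data.Integer.Divisibility.Signed as Signed using ()
open import Data.Integer.DivMod using (_%ℕ_; _/ℕ_; n%ℕd<d; a≡a%ℕn+[a/ℕn]*n)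
import Data.Integer.Properties as ℤₚ
open import Data.Integer.Tactic.RingSolver using (solve-∀)
open import Data.List as List using (List; []; _∷_; _++_)
open import Data.List.Membership.Propositional using (_∈_)
open import Data.List.Membership.Propositional.Properties using (∈-++⁺ˡ; ∈-++⁺ʳ)
import Data.List.Properties as Listₚ
open import Data.List.Relation.Unary.Any using (here; there)
open import Data.Maybe using (Maybe; just; nothing)
open import Data.Nat as ℕ using (ℕ; zero; suc; z≤n; s≤s; _!; _%_; _/_; _∸_; _≤_)
open import Data.Nat.Coprimality using (prime⇒coprime; coprime-Bézout)
import Data.Nat.Divisibility as ℕᵈ
open import Data.Nat.DivMod using (m≡m%n+[m/n]*n; m*n/n≡m; m%n<n; [m+kn]%n≡m%n)
open import Data.Nat.GCD using (module Bézout)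
open import Data.Nat.Primality using (Prime; euclidsLemma; prime⇒irreducible; prime⇒nonZero; ¬prime[1])
import Data.Nat.Properties as ℕₚ
import Data.Nat.Tactic.RingSolver as ℕ-Solver
open import Data.Product using (Σ; _×_; _,_; ∃; proj₁; proj₂)
open import Data.Sum using (_⊎_; inj₁; inj₂; [_,_]′)
open import Function using (_∘_; id)
open import Level using (0ℓ)
open import Relation.Binary.Definitions using (tri<; tri≈; tri>)
open import Relation.Binary.PropositionalEquality as ≡ using (_≡_; _≢_)
open import Relation.Binary.Structures using (IsEquivalence)
open import Relation.Nullary using (¬_; Dec; yes; no; does)
open import Relation.Nullary.Decidable using (¬?)

-- Replacing j by -j does more than change a sign: f(i, -j) = -f(j, i). A single group of factors
-- thus depends on which of ± si lies in {1, ..., h}, and in general only the product of the groups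
-- of s and 1/s is under control. Hence the constant use of involutions: the terms of a product may
-- be exchanged for others as long as the products over pairs and the fixed terms agree. A group
-- with s² = -1 is its own partner, but then i ↦ ± si is itself an involution of {1, ..., h}, and
-- the same device works inside the group.
--
-- The Lucas numbers come from parity. T is an h-th power up to sign, so for odd h one irrational
-- factor is left over: α^h δ in the split case and γ δ in the other, with δ = α - β. Binet's
-- formula gives u_h δ = 2 α^h, respectively u_(h+1) δ = 2 γ. Multiplying by δ turns this factor
-- into δ² u / 2, which explains both the division by 2 and the additional power of A² + 4.

-- Products over an index set with an involution.

module Involution {n : ℕ} (σ : Fin n → Fin n) (σσ : ∀ i → σ (σ i) ≡ i) where

  lower fixed : Fin n → Bool
  lower i = does (i <? σ i)
  fixed i = does (i ≟ σ i)

  -- The Boolean values are part of each case so that `rewrite` can evaluate every conditional in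
  -- `at` simultaneously.
  data Position (i : Fin n) : Set where
    below : lower i ≡ true  → lower (σ i) ≡ false → fixed i ≡ false → Position i
    above : lower i ≡ false → lower (σ i) ≡ true  → fixed i ≡ false → Position i
    equal : lower i ≡ false → lower (σ i) ≡ false → i ≡ σ i → fixed i ≡ true → Position i

  position : ∀ i → Position i
  position i with i <? σ i in p | σ i <? σ (σ i) in q | i ≟ σ i in r
  ... | yes i<j | _ | yes e = ⊥-elim (Finₚ.<-irrefl e i<j)
  ... | yes i<j | yes j<k | no _ = ⊥-elim (Finₚ.<-asym {x = i} {y = σ i} i<j (≡.subst (σ i Fin.<_) (σσ i) j<k))
  ... | yes _ | no _ | no _ = below (≡.cong does p) (≡.cong does q) (≡.cong does r)
  ... | no _ | yes j<k | yes e = ⊥-elim (Finₚ.<-irrefl (≡.cong σ e) j<k)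
  ... | no _ | no _ | yes e = equal (≡.cong does p) (≡.cong does q) e (≡.cong does r)
  ... | no _ | yes _ | no _ = above (≡.cong does p) (≡.cong does q) (≡.cong does r)
  ... | no i≮j | no j≮k | no i≢j with Finₚ.<-cmp i (σ i)
  ...   | tri< i<j _ _ = ⊥-elim (i≮j i<j)
  ...   | tri≈ _ e _ = ⊥-elim (i≢j e)
  ...   | tri> _ _ j<i = ⊥-elim (j≮k (≡.subst (σ i Fin.<_) (≡.sym (σσ i)) j<i))

  module Products {c ℓ} (M : CommutativeMonoid c ℓ) where
    open CommutativeMonoid M
    open Sum M
    open CMSolver M using (solve; _⊕_; _⊜_) renaming (id to ∅)
    open import Relation.Binary.Reasoning.Setoid setoid

    at : (Fin n → Bool) → (Fin n → Carrier) → Fin n → Carrier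
    at b f i = if b i then f i else ε

    sum-∘σ : ∀ f → sum f ≈ sum (f ∘ σ)
    sum-∘σ f = sum-permute f (permutation σ σ σσ σσ)

    -- A pair is charged to its smaller index: the terms at the larger indices are moved there by
    -- reindexing along `σ`.
    sum-by-pairs : ∀ f → sum f ≈ sum (λ i → at fixed f i ∙ at lower (λ j → f j ∙ f (σ j)) i)
    sum-by-pairs f = begin
      sum f
        ≈⟨ sum-cong-≋ split ⟩
      sum (λ i → (at fixed f i ∙ at lower f i) ∙ at (lower ∘ σ) f i)
        ≈⟨ ∑-distrib-+ (λ i → at fixed f i ∙ at lower f i) (at (lower ∘ σ) f) ⟩
      sum (λ i → at fixed f i ∙ at lower f i) ∙ sum (at (lower ∘ σ) f)
        ≈⟨ ∙-congˡ (sum-∘σ (at (lower ∘ σ) f)) ⟩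
      sum (λ i → at fixed f i ∙ at lower f i) ∙ sum (at (lower ∘ σ) f ∘ σ)
        ≈⟨ ∑-distrib-+ (λ i → at fixed f i ∙ at lower f i) (at (lower ∘ σ) f ∘ σ) ⟨
      sum (λ i → (at fixed f i ∙ at lower f i) ∙ at (lower ∘ σ) f (σ i))
        ≈⟨ sum-cong-≋ join ⟩
      sum (λ i → at fixed f i ∙ at lower (λ j → f j ∙ f (σ j)) i) ∎
      where
      split : ∀ i → f i ≈ (at fixed f i ∙ at lower f i) ∙ at (lower ∘ σ) f i
      split i with position i
      ... | below p q r rewrite p | q | r = solve 1 (λ x → x ⊜ (∅ ⊕ x) ⊕ ∅) refl (f i)
      ... | above p q r rewrite p | q | r = solve 1 (λ x → x ⊜ (∅ ⊕ ∅) ⊕ x) refl (f i)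
      ... | equal p q _ r rewrite p | q | r = solve 1 (λ x → x ⊜ (x ⊕ ∅) ⊕ ∅) refl (f i)
      join : ∀ i → (at fixed f i ∙ at lower f i) ∙ at (lower ∘ σ) f (σ i) ≈
                   at fixed f i ∙ at lower (λ j → f j ∙ f (σ j)) i
      join i rewrite σσ i with lower i
      ... | true  = assoc _ _ _
      ... | false = assoc _ _ _ ○ ∙-congˡ (identityˡ ε)
        where _○_ = trans

    -- The terms of `f` and `g` may differ individually. This lets a group of factors be exchanged
    -- for an h-th power although only the product of two paired groups is known.
    sum-pairs-cong : ∀ f g →
      (∀ i → i ≢ σ i → f i ∙ f (σ i) ≈ g i ∙ g (σ i)) → (∀ i → i ≡ σ i → f i ≈ g i) →
      sum f ≈ sum g
    sum-pairs-cong f g pairs fixes =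
      trans (sum-by-pairs f) (trans (sum-cong-≋ same) (sym (sum-by-pairs g)))
      where
      same : ∀ i → at fixed f i ∙ at lower (λ j → f j ∙ f (σ j)) i ≈
                   at fixed g i ∙ at lower (λ j → g j ∙ g (σ j)) i
      same i with position i
      ... | below p _ r rewrite p | r = ∙-congˡ (pairs i (not-fixed r))
        where
        not-fixed : fixed i ≡ false → i ≢ σ i
        not-fixed r e with i ≟ σ i
        not-fixed () e | yes _
        ... | no ne = ne e
      ... | above p _ r rewrite p | r = refl
      ... | equal p _ e r rewrite p | r = ∙-congʳ (fixes i e)

  module FixedPointFree (free : ∀ i → i ≢ σ i) where

    private
      ind : Bool → ℕ
      ind b = if b then 1 else 0

      module Σℕ = Sum ℕₚ.+-0-commutativeMonoid

    orbits : ℕ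
    orbits = Σℕ.sum (ind ∘ lower)

    orbits+orbits : orbits ℕ.+ orbits ≡ n
    orbits+orbits = begin
      orbits ℕ.+ orbits ≡⟨ ≡.cong (orbits ℕ.+_) (sum-∘σ (ind ∘ lower)) ⟩
      orbits ℕ.+ Σℕ.sum (ind ∘ lower ∘ σ) ≡⟨ Σℕ.∑-distrib-+ (ind ∘ lower) (ind ∘ lower ∘ σ) ⟨
      Σℕ.sum (λ i → ind (lower i) ℕ.+ ind (lower (σ i))) ≡⟨ Σℕ.sum-cong-≗ one ⟩
      Σℕ.sum {n} (λ _ → 1) ≡⟨ ones n ⟩
      n ∎
      where
      open ≡.≡-Reasoning
      open Products ℕₚ.+-0-commutativeMonoid using (sum-∘σ)
      one : ∀ i → ind (lower i) ℕ.+ ind (lower (σ i)) ≡ 1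
      one i with position i
      ... | below p q _ rewrite p | q = ≡.refl
      ... | above p q _ rewrite p | q = ≡.refl
      ... | equal _ _ e _ = ⊥-elim (free i e)
      ones : ∀ m → Σℕ.sum {m} (λ _ → 1) ≡ m
      ones zero = ≡.refl
      ones (suc m) = ≡.cong suc (ones m)

    module _ {c ℓ} (M : CommutativeMonoid c ℓ) where
      open CommutativeMonoid M
      open Sum M
      open Products M
      open CMSolver M using (solve; _⊕_; _⊜_) renaming (id to ∅)
      open import Algebra.Properties.Monoid.Mult monoid using () renaming (_×_ to _·_)

      private
        sum-ind : ∀ {m} (b : Fin m → Bool) y →
                  sum (λ i → if b i then y else ε) ≈ Σℕ.sum (ind ∘ b) · y
        sum-ind {zero} b y = refl
        sum-ind {suc m} b y with b zero
        ... | true = ∙-congˡ (sum-ind (b ∘ suc) y)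
        ... | false = trans (identityˡ _) (sum-ind (b ∘ suc) y)

      -- The comparison function `g` carries `y` at the smaller index of each pair only, so `y` is
      -- counted once per orbit while the weight `w` is counted at every index.
      sum-weighted-pairs : ∀ f w y → (∀ i → f i ∙ f (σ i) ≈ y ∙ (w i ∙ w (σ i))) →
        sum f ≈ (orbits · y) ∙ sum w
      sum-weighted-pairs f w y pairs =
        trans (sum-pairs-cong f g (λ i _ → trans (pairs i) (sym (g-pairs i))) (λ i e → ⊥-elim (free i e)))
        (trans (∑-distrib-+ (λ i → if lower i then y else ε) w) (∙-congʳ (sum-ind lower y)))
        where
        g : Fin n → Carrier
        g i = (if lower i then y else ε) ∙ w i
        g-pairs : ∀ i → g i ∙ g (σ i) ≈ y ∙ (w i ∙ w (σ i))
        g-pairs i with position i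
        ... | below p q _ rewrite p | q =
          solve 3 (λ y a b → (y ⊕ a) ⊕ (∅ ⊕ b) ⊜ y ⊕ (a ⊕ b)) refl y (w i) (w (σ i))
        ... | above p q _ rewrite p | q =
          solve 3 (λ y a b → (∅ ⊕ a) ⊕ (y ⊕ b) ⊜ y ⊕ (a ⊕ b)) refl y (w i) (w (σ i))
        ... | equal _ _ e _ = ⊥-elim (free i e)

-- Congruence modulo p and the resulting field.

module Congruence (p : ℕ) where
  open import Data.Integer using (_+_; _*_; -_; _-_; _^_)

  infix 4 _≈_ _≉_ _≈?_

  -- A record rather than a divisibility statement, so that both sides can be inferred from the type.
  record _≈_ (a b : ℤ) : Set where
    constructor by
    field
      quotient : ℤ
      equality : a - b ≡ quotient * + p

  _≉_ : ℤ → ℤ → Set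
  a ≉ b = ¬ a ≈ b

  ≈⇒∣ : ∀ {a b} → a ≈ b → (+ p) ℤD.∣ (a - b)
  ≈⇒∣ (by q e) = Signed.∣⇒∣ᵤ (Signed.divides q e)

  ∣⇒≈ : ∀ {a b} → (+ p) ℤD.∣ (a - b) → a ≈ b
  ∣⇒≈ d with Signed.∣ᵤ⇒∣ d
  ... | Signed.divides q e = by q e

  ∣⇒≈0 : ∀ {a} → (+ p) ℤD.∣ a → a ≈ 0ℤ
  ∣⇒≈0 {a} d = ∣⇒≈ (≡.subst ((+ p) ℤD.∣_) (≡.sym (ℤₚ.+-identityʳ a)) d)

  ≈0⇒∣ : ∀ {a} → a ≈ 0ℤ → (+ p) ℤD.∣ a
  ≈0⇒∣ {a} e = ≡.subst ((+ p) ℤD.∣_) (ℤₚ.+-identityʳ a) (≈⇒∣ e)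

  _≈?_ : ∀ a b → Dec (a ≈ b)
  a ≈? b with p ℕᵈ.∣? ∣ a - b ∣
  ... | yes d = yes (∣⇒≈ d)
  ... | no nd = no λ e → nd (≈⇒∣ e)

  -- This and its variants reduce a congruence to an exact identity: the difference to be treated is
  -- an explicit integer combination of known differences, and the ring solver checks the
  -- combination.
  lincomb₁ : ∀ {a b x y} c → a ≈ b → x - y ≡ c * (a - b) → x ≈ y
  lincomb₁ c (by q e) i = by (c * q)
    (≡.trans i (≡.trans (≡.cong (c *_) e) (≡.sym (ℤₚ.*-assoc c q (+ p)))))

  private
    collect : ∀ c q d r p → c * (q * p) + d * (r * p) ≡ (c * q + d * r) * p
    collect = solve-∀

  lincomb₂ : ∀ {a b a′ b′ x y} c d → a ≈ b → a′ ≈ b′ →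
             x - y ≡ c * (a - b) + d * (a′ - b′) → x ≈ y
  lincomb₂ c d (by q e) (by r f) i = by (c * q + d * r)
    (≡.trans i (≡.trans (≡.cong₂ (λ u v → c * u + d * v) e f) (collect c q d r (+ p))))

  ≈-reflexive : ∀ {a b} → a ≡ b → a ≈ b
  ≈-reflexive {a} ≡.refl = by 0ℤ (ℤₚ.+-inverseʳ a)

  ≈-refl : ∀ {a} → a ≈ a
  ≈-refl = ≈-reflexive ≡.refl

  ≈-sym : ∀ {a b} → a ≈ b → b ≈ a
  ≈-sym {a} {b} e = lincomb₁ (- 1ℤ) e (identity a b)
    where
    identity : ∀ a b → b - a ≡ - 1ℤ * (a - b)
    identity = solve-∀

  ≈-trans : ∀ {a b c} → a ≈ b → b ≈ c → a ≈ c
  ≈-trans {a} {b} {c} e f = lincomb₂ 1ℤ 1ℤ e f (identity a b c)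
    where
    identity : ∀ a b c → a - c ≡ 1ℤ * (a - b) + 1ℤ * (b - c)
    identity = solve-∀

  lincomb₃ : ∀ {a b a′ b′ a″ b″ x y} c d e → a ≈ b → a′ ≈ b′ → a″ ≈ b″ →
             x - y ≡ c * (a - b) + d * (a′ - b′) + e * (a″ - b″) → x ≈ y
  lincomb₃ {a} {b} {a′} {b′} {a″} {b″} {x} {y} c d e f g h i = lincomb₂ 1ℤ e
    (lincomb₂ {x = x - e * (a″ - b″)} {y} c d f g (≡.trans (regroup x y E)
      (≡.trans (≡.cong (_- E) i) (drop (c * (a - b) + d * (a′ - b′)) E))))
    h (split x y e a″ b″)
    where
    E = e * (a″ - b″)
    regroup : ∀ x y e → x - e - y ≡ x - y - e
    regroup = solve-∀
    drop : ∀ u e → u + e - e ≡ u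
    drop = solve-∀
    split : ∀ x y e a b → x - y ≡ 1ℤ * (x - e * (a - b) - y) + e * (a - b)
    split = solve-∀

  +-cong : ∀ {a b c d} → a ≈ b → c ≈ d → a + c ≈ b + d
  +-cong {a} {b} {c} {d} e f = lincomb₂ 1ℤ 1ℤ e f (identity a b c d)
    where
    identity : ∀ a b c d → a + c - (b + d) ≡ 1ℤ * (a - b) + 1ℤ * (c - d)
    identity = solve-∀

  *-cong : ∀ {a b c d} → a ≈ b → c ≈ d → a * c ≈ b * d
  *-cong {a} {b} {c} {d} e f = lincomb₂ c b e f (identity a b c d)
    where
    identity : ∀ a b c d → a * c - b * d ≡ c * (a - b) + b * (c - d)
    identity = solve-∀

  -‿cong : ∀ {a b} → a ≈ b → - a ≈ - b
  -‿cong {a} {b} e = lincomb₁ (- 1ℤ) e (identity a b)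
    where
    identity : ∀ a b → - a - - b ≡ - 1ℤ * (a - b)
    identity = solve-∀

  ring : CommutativeRing 0ℓ 0ℓ
  ring = record
    { Carrier = ℤ ; _≈_ = _≈_ ; _+_ = _+_ ; _*_ = _*_ ; -_ = -_ ; 0# = 0ℤ ; 1# = 1ℤ
    ; isCommutativeRing = record
      { isRing = record
        { +-isAbelianGroup = record
          { isGroup = record
            { isMonoid = record
              { isSemigroup = record
                { isMagma = record { isEquivalence = equiv ; ∙-cong = +-cong }
                ; assoc = λ a b c → ≈-reflexive (ℤₚ.+-assoc a b c) }
              ; identity = (λ a → ≈-reflexive (ℤₚ.+-identityˡ a)) , λ a → ≈-reflexive (ℤₚ.+-identityʳ a) }
            ; inverse = (λ a → ≈-reflexive (ℤₚ.+-inverseˡ a)) , λ a → ≈-reflexive (ℤₚ.+-inverseʳ a)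
            ; ⁻¹-cong = -‿cong }
          ; comm = λ a b → ≈-reflexive (ℤₚ.+-comm a b) }
        ; *-cong = *-cong
        ; *-assoc = λ a b c → ≈-reflexive (ℤₚ.*-assoc a b c)
        ; *-identity = (λ a → ≈-reflexive (ℤₚ.*-identityˡ a)) , λ a → ≈-reflexive (ℤₚ.*-identityʳ a)
        ; distrib = (λ a b c → ≈-reflexive (ℤₚ.*-distribˡ-+ a b c)) , λ a b c → ≈-reflexive (ℤₚ.*-distribʳ-+ a b c) }
      ; *-comm = λ a b → ≈-reflexive (ℤₚ.*-comm a b) } }
    where
    equiv : IsEquivalence _≈_
    equiv = record { refl = ≈-refl ; sym = ≈-sym ; trans = ≈-trans }

  ^-cong : ∀ {a b} n → a ≈ b → a ^ n ≈ b ^ n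
  ^-cong zero e = ≈-refl
  ^-cong (suc n) e = *-cong e (^-cong n e)

module Primality (p : ℕ) (prime : Prime p) where
  open import Data.Integer using (_+_; _*_; -_; _-_)
  open Congruence p public

  integral : ∀ {a b} → a * b ≈ 0ℤ → a ≈ 0ℤ ⊎ b ≈ 0ℤ
  integral {a} {b} e with euclidsLemma ∣ a ∣ ∣ b ∣ prime (≡.subst (p ℕᵈ.∣_) (ℤₚ.abs-* a b) (≈0⇒∣ e))
  ... | inj₁ d = inj₁ (∣⇒≈0 d)
  ... | inj₂ d = inj₂ (∣⇒≈0 d)

  cancelˡ : ∀ {a} → a ≉ 0ℤ → ∀ {b c} → a * b ≈ a * c → b ≈ c
  cancelˡ {a} a≉0 {b} {c} e with integral {a} {b - c} (lincomb₁ 1ℤ e (identity a b c))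
    where
    identity : ∀ a b c → a * (b - c) - 0ℤ ≡ 1ℤ * (a * b - a * c)
    identity = solve-∀
  ... | inj₁ a≈0 = ⊥-elim (a≉0 a≈0)
  ... | inj₂ d = lincomb₁ 1ℤ d (identity b c)
    where
    identity : ∀ b c → b - c ≡ 1ℤ * (b - c - 0ℤ)
    identity = solve-∀

  *-≉0 : ∀ {a b} → a ≉ 0ℤ → b ≉ 0ℤ → a * b ≉ 0ℤ
  *-≉0 a≉0 b≉0 e with integral e
  ... | inj₁ a≈0 = a≉0 a≈0
  ... | inj₂ b≈0 = b≉0 b≈0

  square-cases : ∀ {a b} → a * a ≈ b * b → a ≈ b ⊎ a ≈ - b
  square-cases {a} {b} e with integral {a - b} {a + b} (lincomb₁ 1ℤ e (identity a b))
    where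
    identity : ∀ a b → (a - b) * (a + b) - 0ℤ ≡ 1ℤ * (a * a - b * b)
    identity = solve-∀
  ... | inj₁ d = inj₁ (lincomb₁ 1ℤ d (identity a b))
    where
    identity : ∀ a b → a - b ≡ 1ℤ * (a - b - 0ℤ)
    identity = solve-∀
  ... | inj₂ d = inj₂ (lincomb₁ 1ℤ d (identity a b))
    where
    identity : ∀ a b → a - - b ≡ 1ℤ * (a + b - 0ℤ)
    identity = solve-∀

-- The half-system {1, ..., h} as the group of nonzero residues modulo sign.

module HalfSystem (p : ℕ) (prime : Prime p) (h : ℕ) (p≡ : p ≡ suc (h ℕ.+ h)) where
  open import Data.Integer using (_+_; _*_; -_; _-_)
  open Primality p prime public

  val : Fin h → ℤ
  val k = + suc (toℕ k)

  sq : Fin h → ℤ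
  sq k = val k * val k

  private
    instance
      p≢0 : ℕ.NonZero p
      p≢0 = ≡.subst ℕ.NonZero (≡.sym p≡) _

    index<h : ∀ k → suc (toℕ k) ℕ.≤ h
    index<h k = Finₚ.toℕ<n k

    h+h<p : h ℕ.+ h ℕ.< p
    h+h<p = ℕₚ.≤-reflexive (≡.sym p≡)

    h<p : h ℕ.< p
    h<p = ℕₚ.≤-<-trans (ℕₚ.m≤m+n h h) h+h<p

  0<h : 0 ℕ.< h
  0<h = positive h (≡.subst Prime p≡ prime)
    where
    positive : ∀ n → Prime (suc (n ℕ.+ n)) → 0 ℕ.< n
    positive zero q = ⊥-elim (¬prime[1] q)
    positive (suc n) _ = s≤s z≤n

  +≉0 : ∀ {n} → suc n ℕ.< p → + suc n ≉ 0ℤ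
  +≉0 n<p e = ℕₚ.<⇒≱ n<p (ℕᵈ.∣⇒≤ (≈0⇒∣ e))

  1≉0 : 1ℤ ≉ 0ℤ
  1≉0 = +≉0 (ℕₚ.≤-<-trans 0<h h<p)

  one : Fin h
  one = fromℕ< 0<h

  toℕ-one : toℕ one ≡ 0
  toℕ-one = Finₚ.toℕ-fromℕ< 0<h

  val-one : val one ≡ 1ℤ
  val-one = ≡.cong (λ k → + suc k) toℕ-one

  sq-one : sq one ≡ 1ℤ
  sq-one = ≡.cong₂ _*_ val-one val-one

  val≉0 : ∀ k → val k ≉ 0ℤ
  val≉0 k = +≉0 (ℕₚ.≤-<-trans (index<h k) h<p)

  sq≉0 : ∀ k → sq k ≉ 0ℤ
  sq≉0 k = *-≉0 (val≉0 k) (val≉0 k)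

  small-≈ : ∀ {m n} → m ℕ.< p → n ℕ.< p → + m ≈ + n → m ≡ n
  small-≈ {m} {n} m<p n<p e = ℤₚ.+-injective (ℤₚ.i-j≡0⇒i≡j (+ m) (+ n) (ℤₚ.∣i∣≡0⇒i≡0 (multiple (≈⇒∣ e))))
    where
    bound : ∣ + m - + n ∣ ℕ.< p
    bound = ℕₚ.≤-<-trans
      (≡.subst (ℕ._≤ m ℕ.⊔ n) (≡.cong ∣_∣ (≡.sym (ℤₚ.m-n≡m⊖n m n))) (ℤₚ.∣m⊝n∣≤m⊔n m n))
      (ℕₚ.⊔-lub m<p n<p)
    multiple : p ℕᵈ.∣ ∣ + m - + n ∣ → ∣ + m - + n ∣ ≡ 0
    multiple d with ∣ + m - + n ∣ | bound
    ... | zero  | _ = ≡.refl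
    ... | suc k | b = ⊥-elim (ℕₚ.<⇒≱ b (ℕᵈ.∣⇒≤ d))

  -- The opposite sign is excluded because the sum of two elements of {1, ..., h} lies strictly
  -- between 0 and p. Equality of classes is therefore always tested on squares, without tracking
  -- signs.
  sq-injective : ∀ {k l} → sq k ≈ sq l → k ≡ l
  sq-injective {k} {l} e with square-cases {val k} {val l} e
  ... | inj₁ v = Finₚ.toℕ-injective (ℕₚ.suc-injective
        (small-≈ (ℕₚ.≤-<-trans (index<h k) h<p) (ℕₚ.≤-<-trans (index<h l) h<p) v))
  ... | inj₂ v = ⊥-elim (+≉0 (ℕₚ.≤-<-trans (ℕₚ.+-mono-≤ (index<h k) (index<h l)) h+h<p)
        (lincomb₁ 1ℤ v (identity (val k) (val l))))
    where
    identity : ∀ a b → a + b - 0ℤ ≡ 1ℤ * (a - - b)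
    identity = solve-∀

  -- One of the residues r and p - r is at most h, and squaring forgets which.
  representative : ∀ n → n ≉ 0ℤ → ∃ λ k → sq k ≈ n * n
  representative n n≉0 = result
    where
    r = n %ℕ p
    n≈r : n ≈ + r
    n≈r = by (n /ℕ p) (≡.trans (≡.cong (_- + r) (a≡a%ℕn+[a/ℕn]*n n p)) (identity (+ r) (n /ℕ p * + p)))
      where
      identity : ∀ r q → r + q - r ≡ q
      identity = solve-∀
    from : ∀ m → n * n ≈ + m * + m → m ≢ 0 → m ℕ.≤ h → ∃ λ k → sq k ≈ n * n
    from zero _ m≢0 _ = ⊥-elim (m≢0 ≡.refl)
    from (suc m) e _ m<h = fromℕ< m<h ,
      ≡.subst (λ i → + suc i * + suc i ≈ n * n) (≡.sym (Finₚ.toℕ-fromℕ< m<h)) (≈-sym e)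
    result : ∃ λ k → sq k ≈ n * n
    result with r ℕ.≤? h
    ... | yes r≤h = from r (*-cong n≈r n≈r) (λ r≡0 → n≉0 (≈-trans n≈r (≈-reflexive (≡.cong +_ r≡0)))) r≤h
    ... | no r≰h = from (p ℕ.∸ r) (≈-trans (*-cong n≈r n≈r) (≈-sym (lincomb₂ s (- + r) s≈-r s≈-r (identity s (+ r)))))
                     (ℕₚ.m>n⇒m∸n≢0 r<p) (ℕₚ.m≤n+o⇒m∸n≤o p r p≤r+h)
      where
      r<p : r ℕ.< p
      r<p = n%ℕd<d n p
      p≤r+h : p ℕ.≤ r ℕ.+ h
      p≤r+h = ≡.subst (ℕ._≤ r ℕ.+ h) (≡.sym p≡) (ℕₚ.+-monoˡ-≤ h (ℕₚ.≰⇒> r≰h))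
      s = + (p ℕ.∸ r)
      s≈-r : s ≈ - + r
      s≈-r = by 1ℤ (≡.trans (identity s (+ r)) (≡.trans (≡.cong +_ (ℕₚ.m∸n+n≡m (ℕₚ.<⇒≤ r<p))) (≡.sym (ℤₚ.*-identityˡ (+ p)))))
        where
        identity : ∀ s r → s - - r ≡ s + r
        identity = solve-∀
      identity : ∀ s r → s * s - r * r ≡ s * (s - - r) + - r * (s - - r)
      identity = solve-∀

  inverse : ∀ k → ∃ λ b → val k * b ≈ 1ℤ
  inverse k with coprime-Bézout (prime⇒coprime {n = suc (toℕ k)} prime (ℕₚ.≤-<-trans (index<h k) h<p))
  ... | Bézout.+- x y e = - + y , by (- + x) (≡.trans (identity (val k) (+ y))
          (≡.trans (≡.cong -_ (≡.trans (≡.trans (≡.cong (λ t → + 1 + t) (≡.sym (ℤₚ.pos-* y (suc (toℕ k))))) (≡.cong +_ e)) (ℤₚ.pos-* x p))) (ℤₚ.neg-distribˡ-* (+ x) (+ p))))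
    where
    identity : ∀ k y → k * - y - 1ℤ ≡ - (1ℤ + y * k)
    identity = solve-∀
  ... | Bézout.-+ x y e = + y , by (+ x) (≡.trans (≡.cong (_- 1ℤ) (≡.trans (ℤₚ.*-comm (val k) (+ y))
          (≡.trans (≡.sym (ℤₚ.pos-* y (suc (toℕ k)))) (≡.trans (≡.cong +_ (≡.sym e)) (≡.cong (λ t → + 1 + t) (ℤₚ.pos-* x p)))))) (identity (+ x * + p)))
    where
    identity : ∀ t → 1ℤ + t - 1ℤ ≡ t
    identity = solve-∀

  inverse≉0 : ∀ {k b} → val k * b ≈ 1ℤ → b ≉ 0ℤ
  inverse≉0 {k} {b} e b≈0 = 1≉0 (lincomb₂ (- 1ℤ) (val k) e b≈0 (identity (val k) b))
    where
    identity : ∀ k b → 1ℤ - 0ℤ ≡ - 1ℤ * (k * b - 1ℤ) + k * (b - 0ℤ)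
    identity = solve-∀

  private
    star-spec : ∀ s → ∃ λ t → sq s * sq t ≈ 1ℤ
    star-spec s with inverse s
    ... | b , e with representative b (inverse≉0 {s} {b} e)
    ...   | t , f = t , lincomb₂ (sq s) (val s * b + 1ℤ) f e (identity (val s) b (sq t))
      where
      identity : ∀ s b t → s * s * t - 1ℤ ≡ s * s * (t - b * b) + (s * b + 1ℤ) * (s * b - 1ℤ)
      identity = solve-∀

  -- abstract: otherwise goals unfold to the Euclidean algorithm behind the inverse.
  abstract
    act : Fin h → Fin h → Fin h
    act s i = proj₁ (representative (val s * val i) (*-≉0 (val≉0 s) (val≉0 i)))

    sq-act : ∀ s i → sq (act s i) ≈ sq s * sq i
    sq-act s i = ≈-trans (proj₂ (representative (val s * val i) (*-≉0 (val≉0 s) (val≉0 i))))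
      (≈-reflexive (identity (val s) (val i)))
      where
      identity : ∀ s i → s * i * (s * i) ≡ s * s * (i * i)
      identity = solve-∀

    star : Fin h → Fin h
    star s = proj₁ (star-spec s)

    sq-star : ∀ s → sq s * sq (star s) ≈ 1ℤ
    sq-star s = proj₂ (star-spec s)

  star-unique : ∀ {s t} → sq s * sq t ≈ 1ℤ → t ≡ star s
  star-unique {s} {t} e = sq-injective (cancelˡ (sq≉0 s) (≈-trans e (≈-sym (sq-star s))))

  star-involutive : ∀ s → star (star s) ≡ s
  star-involutive s = ≡.sym (star-unique (≈-trans (≈-reflexive (ℤₚ.*-comm (sq (star s)) (sq s))) (sq-star s)))

  act-star : ∀ s i → act (star s) (act s i) ≡ i
  act-star s i = sq-injective (≈-trans (sq-act (star s) (act s i))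
    (lincomb₂ (sq (star s)) (sq i) (sq-act s i) (sq-star s) (identity (sq s) (sq (star s)) (sq i) (sq (act s i)))))
    where
    identity : ∀ s t i a → t * a - i ≡ t * (a - s * i) + i * (s * t - 1ℤ)
    identity = solve-∀

  act-star′ : ∀ s i → act s (act (star s) i) ≡ i
  act-star′ s i = ≡.subst (λ t → act t (act (star s) i) ≡ i) (star-involutive s) (act-star (star s) i)

  module _ {c ℓ} (M : CommutativeMonoid c ℓ) where
    open CommutativeMonoid M using () renaming (_≈_ to _≋_)
    open Sum M

    sum-act : ∀ s f → sum f ≋ sum (f ∘ act s)
    sum-act s f = sum-permute f (permutation (act s) (act (star s)) (act-star′ s) (act-star s))

    sum-actˡ : ∀ s f → sum f ≋ sum (λ i → f (act i s))
    sum-actˡ s f = CommutativeMonoid.trans M (sum-act s f)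
      (CommutativeMonoid.reflexive M (sum-cong-≗ (λ i → ≡.cong f (act-comm i))))
      where
      act-comm : ∀ i → act s i ≡ act i s
      act-comm i = sq-injective (≈-trans (sq-act s i) (≈-trans (≈-reflexive (ℤₚ.*-comm (sq s) (sq i))) (≈-sym (sq-act i s))))

  fixed-square : ∀ {s} → s ≡ star s → sq s ≈ 1ℤ ⊎ sq s ≈ - 1ℤ
  fixed-square {s} e = square-cases {sq s} {1ℤ} (≡.subst (λ t → sq s * sq t ≈ 1ℤ) (≡.sym e) (sq-star s))

  sq≈1⇒one : ∀ {s} → sq s ≈ 1ℤ → s ≡ one
  sq≈1⇒one e = sq-injective (≈-trans e (≈-reflexive (≡.sym sq-one)))

  star-one : one ≡ star one
  star-one = star-unique (≈-reflexive (≡.cong₂ _*_ sq-one sq-one))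

-- Repeated terms and single exceptional terms in finite products.

module SumLemmas {c ℓ} (M : CommutativeMonoid c ℓ) where
  open CommutativeMonoid M
  open Sum M
  open import Algebra.Properties.Monoid.Mult monoid using () renaming (_×_ to _·_)

  sum-· : ∀ n {m} (f : Fin m → Carrier) → sum (λ i → n · f i) ≈ n · sum f
  sum-· zero {m} f = sum-replicate-zero m
  sum-· (suc n) f = trans (∑-distrib-+ f (λ i → n · f i)) (∙-congˡ (sum-· n f))

  sum-scale : ∀ {n} x (f : Fin n → Carrier) → sum (λ i → x ∙ f i) ≈ (n · x) ∙ sum f
  sum-scale {n} x f = trans (∑-distrib-+ (λ _ → x) f) (∙-congʳ (sum-replicate n))

  sum-snoc : ∀ n (g : ℕ → Carrier) → sum {suc n} (g ∘ toℕ) ≈ sum {n} (g ∘ toℕ) ∙ g n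
  sum-snoc n g = trans (sum-init-last {n} (g ∘ toℕ))
    (∙-cong (reflexive (sum-cong-≗ {n} (λ i → ≡.cong g (Finₚ.toℕ-inject₁ i)))) (reflexive (≡.cong g (Finₚ.toℕ-fromℕ n))))

  infixl 9 _[_≔_]
  _[_≔_] : ∀ {n} → (Fin n → Carrier) → Fin n → Carrier → Fin n → Carrier
  (f [ k ≔ v ]) i = if does (i ≟ k) then v else f i

  ≔-at : ∀ {n} (f : Fin n → Carrier) k v → (f [ k ≔ v ]) k ≡ v
  ≔-at f k v with k ≟ k
  ... | yes _ = ≡.refl
  ... | no k≢k = ⊥-elim (k≢k ≡.refl)

  ≔-off : ∀ {n} (f : Fin n → Carrier) {k} v {i} → i ≢ k → (f [ k ≔ v ]) i ≡ f i
  ≔-off f {k} v {i} i≢k with i ≟ k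
  ... | yes e = ⊥-elim (i≢k e)
  ... | no _ = ≡.refl

  sum-single : ∀ {n} (k : Fin n) v → sum ((λ _ → ε) [ k ≔ v ]) ≈ v
  sum-single {suc n} zero v = trans (∙-congˡ (sum-replicate-zero n)) (identityʳ v)
  sum-single {suc n} (suc k) v = trans (identityˡ _) (sum-single k v)

  sum-≔ : ∀ {n} (f : Fin n → Carrier) k v → sum (f [ k ≔ v ]) ≈ v ∙ sum (f [ k ≔ ε ])
  sum-≔ f k v = trans (sum-cong-≋ split)
    (trans (∑-distrib-+ ((λ _ → ε) [ k ≔ v ]) (f [ k ≔ ε ])) (∙-congʳ (sum-single k v)))
    where
    split : ∀ i → (f [ k ≔ v ]) i ≈ ((λ _ → ε) [ k ≔ v ]) i ∙ (f [ k ≔ ε ]) i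
    split i with does (i ≟ k)
    ... | true = sym (identityʳ v)
    ... | false = sym (identityˡ (f i))

^-distribʳ-* : ∀ a b n → (a ℤ.* b) ℤ.^ n ≡ a ℤ.^ n ℤ.* b ℤ.^ n
^-distribʳ-* a b zero = ≡.refl
^-distribʳ-* a b (suc n) = ≡.trans (≡.cong (a ℤ.* b ℤ.*_) (^-distribʳ-* a b n)) (identity a b (a ℤ.^ n) (b ℤ.^ n))
  where
  identity : ∀ a b x y → a ℤ.* b ℤ.* (x ℤ.* y) ≡ a ℤ.* x ℤ.* (b ℤ.* y)
  identity = solve-∀

^-double : ∀ a n → a ℤ.^ (n ℕ.+ n) ≡ (a ℤ.* a) ℤ.^ n
^-double a n = ≡.trans (ℤₚ.^-distribˡ-+-* a n n) (≡.sym (^-distribʳ-* a a n))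

-- The theorems of Wilson and Fermat on the half-system, and T as a full grid product.

module Products (p : ℕ) (prime : Prime p) (h : ℕ) (p≡ : p ≡ suc (h ℕ.+ h)) where
  open import Data.Integer using (_+_; _*_; -_; _-_; _^_)
  open HalfSystem p prime h p≡ public
  open CommutativeRing ring public using (*-commutativeMonoid; setoid)
  open Sum *-commutativeMonoid public renaming (sum to ∏)
  open SumLemmas *-commutativeMonoid public
  open import Algebra.Properties.Monoid.Mult (CommutativeMonoid.monoid *-commutativeMonoid) public using () renaming (_×_ to _·_)
  open import Relation.Binary.Reasoning.Setoid setoid

  ·≡^ : ∀ n a → n · a ≡ a ^ n
  ·≡^ zero a = ≡.refl
  ·≡^ (suc n) a = ≡.cong (a *_) (·≡^ n a)

  ∏-^ : ∀ n {m} (f : Fin m → ℤ) → ∏ (λ i → f i ^ n) ≈ ∏ f ^ n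
  ∏-^ n f = ≡.subst₂ _≈_ (sum-cong-≗ (λ i → ·≡^ n (f i))) (·≡^ n (∏ f)) (sum-· n f)

  ∏-scale : ∀ {n} a (f : Fin n → ℤ) → ∏ (λ i → a * f i) ≈ a ^ n * ∏ f
  ∏-scale {n} a f = ≡.subst (λ t → ∏ (λ i → a * f i) ≈ t * ∏ f) (·≡^ n a) (sum-scale a f)

  ∏-≉0 : ∀ {n} (f : Fin n → ℤ) → (∀ i → f i ≉ 0ℤ) → ∏ f ≉ 0ℤ
  ∏-≉0 {zero} f _ = 1≉0
  ∏-≉0 {suc n} f f≉0 = *-≉0 (f≉0 zero) (∏-≉0 (f ∘ suc) (f≉0 ∘ suc))

  fact : ℤ
  fact = ∏ val

  ∏val≡! : ∀ n → ∏ {n} (λ i → + suc (toℕ i)) ≈ + (n !)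
  ∏val≡! zero = ≈-refl
  ∏val≡! (suc n) = begin
    ∏ {suc n} (λ i → + suc (toℕ i)) ≈⟨ sum-snoc n (λ i → + suc i) ⟩
    ∏ {n} (λ i → + suc (toℕ i)) * + suc n ≈⟨ *-cong (∏val≡! n) (≈-refl {+ suc n}) ⟩
    + (n !) * + suc n ≡⟨ ℤₚ.*-comm (+ (n !)) (+ suc n) ⟩
    + suc n * + (n !) ≡⟨ ℤₚ.pos-* (suc n) (n !) ⟨
    + (suc n !) ∎

  ∏sq : ∏ sq ≈ fact * fact
  ∏sq = ∑-distrib-+ val val

  module Star where
    open Involution star star-involutive public
    open Involution.Products star star-involutive *-commutativeMonoid public

  -- Wilson's theorem, since (p - 1)! ≡ (-1)^h (h!)². In the product of all -s², inverse pairs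
  -- cancel, a class with s² = -1 contributes 1, and s = 1 contributes the remaining -1.
  wilson : (- 1ℤ) ^ h * (fact * fact) ≈ - 1ℤ
  wilson = begin
    (- 1ℤ) ^ h * (fact * fact) ≈⟨ *-cong (≈-refl {(- 1ℤ) ^ h}) ∏sq ⟨
    (- 1ℤ) ^ h * ∏ sq ≈⟨ ∏-scale (- 1ℤ) sq ⟨
    ∏ (λ i → - 1ℤ * sq i) ≈⟨ Star.sum-pairs-cong (λ i → - 1ℤ * sq i) g pairs fixes ⟩
    ∏ g ≈⟨ sum-single {h} one (- 1ℤ) ⟩
    - 1ℤ ∎
    where
    g : Fin h → ℤ
    g = (λ _ → 1ℤ) [ one ≔ - 1ℤ ]
    pairs : ∀ i → i ≢ star i → - 1ℤ * sq i * (- 1ℤ * sq (star i)) ≈ g i * g (star i)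
    pairs i i≢ = ≈-trans (≈-trans (≈-reflexive (identity (sq i) (sq (star i)))) (sq-star i))
      (≈-reflexive (≡.sym (≡.cong₂ _*_ (≔-off (λ _ → 1ℤ) (- 1ℤ) i≢1) (≔-off (λ _ → 1ℤ) (- 1ℤ) si≢1))))
      where
      identity : ∀ a b → - 1ℤ * a * (- 1ℤ * b) ≡ a * b
      identity = solve-∀
      i≢1 : i ≢ one
      i≢1 e = i≢ (≡.subst (λ t → t ≡ star t) (≡.sym e) star-one)
      si≢1 : star i ≢ one
      si≢1 e = i≢1 (≡.trans (≡.sym (star-involutive i)) (≡.trans (≡.cong star e) (≡.sym star-one)))
    fixes : ∀ i → i ≡ star i → - 1ℤ * sq i ≈ g i
    fixes i e with i ≟ one
    ... | yes i≡1 = ≈-reflexive (≡.cong (- 1ℤ *_) (≡.trans (≡.cong sq i≡1) sq-one))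
    ... | no i≢1 with fixed-square e
    ...   | inj₁ s≈1 = ⊥-elim (i≢1 (sq≈1⇒one s≈1))
    ...   | inj₂ s≈-1 = lincomb₁ (- 1ℤ) s≈-1 (identity (sq i))
      where
      identity : ∀ s → - 1ℤ * s - 1ℤ ≡ - 1ℤ * (s - - 1ℤ)
      identity = solve-∀

  fact²²≈1 : fact * fact * (fact * fact) ≈ 1ℤ
  fact²²≈1 = lincomb₂ (fact * fact * (fact * fact)) (e * (fact * fact) - 1ℤ)
    (≈-reflexive {1ℤ} {e * e} (≡.sym (≡.trans (≡.sym (^-distribʳ-* (- 1ℤ) (- 1ℤ) h)) (ℤₚ.^-zeroˡ h)))) wilson (identity e (fact * fact))
    where
    e = (- 1ℤ) ^ h
    identity : ∀ e f → f * f - 1ℤ ≡ f * f * (1ℤ - e * e) + (e * f - 1ℤ) * (e * f - - 1ℤ)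
    identity = solve-∀

  -- Multiplication by `s` permutes the squares, so their product is unchanged by the factor
  -- `sq s ^ h` and can be cancelled.
  sq-^h : ∀ s → sq s ^ h ≈ 1ℤ
  sq-^h s = cancelˡ (∏-≉0 sq sq≉0) (begin
    ∏ sq * sq s ^ h ≡⟨ ℤₚ.*-comm (∏ sq) (sq s ^ h) ⟩
    sq s ^ h * ∏ sq ≈⟨ ∏-scale (sq s) sq ⟨
    ∏ (λ i → sq s * sq i) ≈⟨ sum-cong-≋ (sq-act s) ⟨
    ∏ (λ i → sq (act s i)) ≈⟨ sum-act *-commutativeMonoid s sq ⟨
    ∏ sq ≡⟨ ℤₚ.*-identityʳ (∏ sq) ⟨
    ∏ sq * 1ℤ ∎)

  fermat : ∀ {n} → n ≉ 0ℤ → (n * n) ^ h ≈ 1ℤ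
  fermat {n} n≉0 with representative n n≉0
  ... | s , e = ≈-trans (^-cong h (≈-sym e)) (sq-^h s)

  -- With 1 in place of an excluded factor, the filtered product `T` becomes a product over the
  -- whole grid, which can be reindexed freely.
  nz : ℤ → ℤ
  nz x = if does (p ℕᵈ.∣? ∣ x ∣) then 1ℤ else x

  nz-≈0 : ∀ {x} → x ≈ 0ℤ → nz x ≡ 1ℤ
  nz-≈0 {x} e with p ℕᵈ.∣? ∣ x ∣
  ... | yes _ = ≡.refl
  ... | no nd = ⊥-elim (nd (≈0⇒∣ e))

  nz-≉0 : ∀ {x} → x ≉ 0ℤ → nz x ≡ x
  nz-≉0 {x} ne with p ℕᵈ.∣? ∣ x ∣
  ... | yes d = ⊥-elim (ne (∣⇒≈0 d))
  ... | no _ = ≡.refl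

  private
    P : List ℤ → ℤ
    P xs = List.foldr _*_ 1ℤ (List.filter (λ x → ¬? (p ℕᵈ.∣? ∣ x ∣)) xs)

    P-∷ : ∀ x xs → P (x ∷ xs) ≡ nz x * P xs
    P-∷ x xs with p ℕᵈ.∣? ∣ x ∣
    ... | yes _ = ≡.sym (ℤₚ.*-identityˡ (P xs))
    ... | no _ = ≡.refl

    P-++ : ∀ xs ys → P (xs ++ ys) ≡ P xs * P ys
    P-++ [] ys = ≡.sym (ℤₚ.*-identityˡ (P ys))
    P-++ (x ∷ xs) ys = ≡.trans (P-∷ x (xs ++ ys)) (≡.trans (≡.cong (nz x *_) (P-++ xs ys))
      (≡.trans (≡.sym (ℤₚ.*-assoc (nz x) (P xs) (P ys))) (≡.cong (_* P ys) (≡.sym (P-∷ x xs)))))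

    P-row : ∀ n (F : ℕ → ℤ) → P (List.map F (range1 n)) ≈ ∏ {n} (λ j → nz (F (suc (toℕ j))))
    P-row zero F = ≈-refl
    P-row (suc n) F = begin
      P (List.map F (range1 n ++ suc n ∷ [])) ≡⟨ ≡.cong P (Listₚ.map-++ F (range1 n) (suc n ∷ [])) ⟩
      P (List.map F (range1 n) ++ F (suc n) ∷ []) ≡⟨ P-++ (List.map F (range1 n)) (F (suc n) ∷ []) ⟩
      P (List.map F (range1 n)) * P (F (suc n) ∷ []) ≈⟨ *-cong (P-row n F) (≈-reflexive (≡.trans (P-∷ (F (suc n)) []) (ℤₚ.*-identityʳ (nz (F (suc n)))))) ⟩
      ∏ {n} (λ j → nz (F (suc (toℕ j)))) * nz (F (suc n)) ≈⟨ sum-snoc n (λ j → nz (F (suc j))) ⟨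
      ∏ {suc n} (λ j → nz (F (suc (toℕ j)))) ∎

    P-grid : ∀ m n (F : ℕ → ℕ → ℤ) → P (List.concatMap (λ i → List.map (F i) (range1 n)) (range1 m)) ≈
             ∏ {m} (λ i → ∏ {n} (λ j → nz (F (suc (toℕ i)) (suc (toℕ j)))))
    P-grid zero n F = ≈-refl
    P-grid (suc m) n F = begin
      P (List.concatMap row (range1 m ++ suc m ∷ [])) ≡⟨ ≡.cong P (Listₚ.concatMap-++ row (range1 m) (suc m ∷ [])) ⟩
      P (List.concatMap row (range1 m) ++ row (suc m) ++ []) ≡⟨ ≡.cong (λ t → P (List.concatMap row (range1 m) ++ t)) (Listₚ.++-identityʳ (row (suc m))) ⟩
      P (List.concatMap row (range1 m) ++ row (suc m)) ≡⟨ P-++ (List.concatMap row (range1 m)) (row (suc m)) ⟩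
      P (List.concatMap row (range1 m)) * P (row (suc m)) ≈⟨ *-cong (P-grid m n F) (P-row n (F (suc m))) ⟩
      ∏ {m} (λ i → G i) * g m ≈⟨ sum-snoc m g ⟨
      ∏ {suc m} (λ i → G i) ∎
      where
      row : ℕ → List ℤ
      row i = List.map (F i) (range1 n)
      g : ℕ → ℤ
      g i = ∏ {n} (λ j → nz (F (suc i) (suc (toℕ j))))
      G : ∀ {k} → Fin k → ℤ
      G i = g (toℕ i)

  half≡h : (p ℕ.∸ 1) ℕ./ 2 ≡ h
  half≡h = ≡.trans (≡.cong (λ t → (t ℕ.∸ 1) ℕ./ 2) (≡.trans p≡ (≡.cong suc h+h≡h*2))) (m*n/n≡m h 2)
    where
    h+h≡h*2 : h ℕ.+ h ≡ h ℕ.* 2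
    h+h≡h*2 = ≡.trans (≡.cong (h ℕ.+_) (≡.sym (ℕₚ.+-identityʳ h))) (ℕₚ.*-comm 2 h)

  T-as-product : ∀ A → T p A ≈ ∏ {h} (λ i → ∏ {h} (λ j → nz (form A (suc (toℕ i)) (suc (toℕ j)))))
  T-as-product A = ≈-trans (P-grid ((p ℕ.∸ 1) ℕ./ 2) ((p ℕ.∸ 1) ℕ./ 2) (form A))
    (≈-reflexive (≡.cong (λ n → ∏ {n} (λ i → ∏ {n} (λ j → nz (form A (suc (toℕ i)) (suc (toℕ j)))))) half≡h))

  halfFact≈fact : halfFact p ≈ fact
  halfFact≈fact = ≈-trans (≈-reflexive (≡.cong (λ n → + (n !)) half≡h)) (≈-sym (∏val≡! h))

-- The factors of T grouped by the ratio of their indices.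

module Parts (p : ℕ) (prime : Prime p) (h : ℕ) (p≡ : p ≡ suc (h ℕ.+ h)) (A : ℤ) where
  open import Data.Integer using (_+_; _*_; -_; _-_; _^_)
  open Products p prime h p≡ public
  open import Relation.Binary.Reasoning.Setoid setoid

  D : ℤ
  D = A * A + + 4

  F : Fin h → Fin h → ℤ
  F i j = form A (suc (toℕ i)) (suc (toℕ j))

  Φ : Fin h → Fin h → ℤ
  Φ i j = nz (F i j) * nz (F j i)

  -- The factors of T with j ≡ ± s i.
  part : Fin h → ℤ
  part s = ∏ {h} (λ i → nz (F i (act s i)))

  -- In each row `i` every column is `act s i` for exactly one class `s`; exchanging the two
  -- products collects equal ratios.
  T≈∏part : T p A ≈ ∏ part
  T≈∏part = begin
    T p A ≈⟨ T-as-product A ⟩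
    ∏ {h} (λ i → ∏ {h} (λ j → nz (F i j))) ≈⟨ sum-cong-≋ (λ i → sum-actˡ *-commutativeMonoid i (λ j → nz (F i j))) ⟩
    ∏ {h} (λ i → ∏ {h} (λ s → nz (F i (act s i)))) ≈⟨ ∑-comm (λ i s → nz (F i (act s i))) ⟩
    ∏ part ∎

  -- Reindexing the second group by multiplication with `s` returns its column to `i`, which
  -- exchanges the arguments of the form.
  part-star : ∀ s → part s * part (star s) ≈ ∏ {h} (λ i → Φ i (act s i))
  part-star s = begin
    part s * part (star s)
      ≈⟨ *-cong (≈-refl {part s}) (sum-act *-commutativeMonoid s (λ i → nz (F i (act (star s) i)))) ⟩
    part s * ∏ {h} (λ i → nz (F (act s i) (act (star s) (act s i))))
      ≡⟨ ≡.cong (part s *_) (sum-cong-≗ {h} (λ i → ≡.cong (λ k → nz (F (act s i) k)) (act-star s i))) ⟩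
    part s * ∏ {h} (λ i → nz (F (act s i) i))
      ≈⟨ ∑-distrib-+ (λ i → nz (F i (act s i))) (λ i → nz (F (act s i) i)) ⟨
    ∏ {h} (λ i → Φ i (act s i)) ∎

  2≉0 : + 2 ≉ 0ℤ
  2≉0 = +≉0 (≡.subst (2 ℕ.<_) (≡.sym p≡) (s≤s (ℕₚ.+-mono-≤ 0<h 0<h)))

  inv2≡ : inv2 p ≡ + suc h
  inv2≡ = ≡.cong +_ (≡.trans (≡.cong (λ n → suc n ℕ./ 2) p≡) (≡.trans (≡.cong (ℕ._/ 2) 2+2h≡) (m*n/n≡m (suc h) 2)))
    where
    2+2h≡ : suc (suc (h ℕ.+ h)) ≡ suc h ℕ.* 2
    2+2h≡ = ≡.cong (2 ℕ.+_) (≡.trans (≡.cong (h ℕ.+_) (≡.sym (ℕₚ.+-identityʳ h))) (ℕₚ.*-comm 2 h))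

  2*inv2≈1 : + 2 * inv2 p ≈ 1ℤ
  2*inv2≈1 = ≈-trans (≈-reflexive (≡.cong (+ 2 *_) inv2≡)) (by 1ℤ
    (≡.trans (identity (+ h)) (≡.trans (≡.cong +_ (≡.sym p≡)) (≡.sym (ℤₚ.*-identityˡ (+ p))))))
    where
    identity : ∀ x → + 2 * (1ℤ + x) - 1ℤ ≡ 1ℤ + (x + x)
    identity = solve-∀

  -≉0 : ∀ {a} → a ≉ 0ℤ → - a ≉ 0ℤ
  -≉0 {a} a≉0 e = a≉0 (lincomb₁ (- 1ℤ) e (identity a))
    where
    identity : ∀ a → a - 0ℤ ≡ - 1ℤ * (- a - 0ℤ)
    identity = solve-∀

  FF : ∀ i j → F i j * F j i ≡ D * (sq i * sq j) - (sq i + sq j) * (sq i + sq j)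
  FF i j = identity A (val i) (val j)
    where
    identity : ∀ A x y → (x * x - A * x * y - y * y) * (y * y - A * y * x - x * x) ≡
               (A * A + + 4) * (x * x * (y * y)) - (x * x + y * y) * (x * x + y * y)
    identity = solve-∀

  Φ-≉0 : ∀ i j → F i j * F j i ≉ 0ℤ → Φ i j ≡ F i j * F j i
  Φ-≉0 i j ne = ≡.cong₂ _*_
    (nz-≉0 λ e → ne (≈-trans (*-cong e (≈-refl {F j i})) (≈-reflexive (ℤₚ.*-zeroˡ (F j i)))))
    (nz-≉0 λ e → ne (≈-trans (*-cong (≈-refl {F i j}) e) (≈-reflexive (ℤₚ.*-zeroʳ (F i j)))))

  -2A : ℤ
  -2A = - (+ 2 * A)

  -- F i j and F j i add up to −2Aij, so at most one of them vanishes.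
  Φ-≈0 : A ≉ 0ℤ → ∀ i j → F i j * F j i ≈ 0ℤ → Φ i j ≈ -2A * (val i * val j)
  Φ-≈0 A≉0 i j e with integral {F i j} {F j i} e
  ... | inj₁ z = ≈-trans (≈-reflexive (≡.cong₂ _*_ (nz-≈0 z) (nz-≉0 other))) same
    where
    identity : ∀ A x y → 1ℤ * (y * y - A * y * x - x * x) - - (+ 2 * A) * (x * y) ≡
               - 1ℤ * (x * x - A * x * y - y * y - 0ℤ)
    identity = solve-∀
    same : 1ℤ * F j i ≈ -2A * (val i * val j)
    same = lincomb₁ (- 1ℤ) z (identity A (val i) (val j))
    other : F j i ≉ 0ℤ
    other w = *-≉0 (-≉0 (*-≉0 2≉0 A≉0)) (*-≉0 (val≉0 i) (val≉0 j))
      (≈-trans (≈-sym same) (*-cong (≈-refl {1ℤ}) w))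
  ... | inj₂ z = ≈-trans (≈-reflexive (≡.cong₂ _*_ (nz-≉0 other) (nz-≈0 z))) same
    where
    identity : ∀ A x y → (x * x - A * x * y - y * y) * 1ℤ - - (+ 2 * A) * (x * y) ≡
               - 1ℤ * (y * y - A * y * x - x * x - 0ℤ)
    identity = solve-∀
    same : F i j * 1ℤ ≈ -2A * (val i * val j)
    same = lincomb₁ (- 1ℤ) z (identity A (val i) (val j))
    other : F i j ≉ 0ℤ
    other w = *-≉0 (-≉0 (*-≉0 2≉0 A≉0)) (*-≉0 (val≉0 i) (val≉0 j))
      (≈-trans (≈-sym same) (*-cong w (≈-refl {1ℤ})))

  d : Fin h → ℤ
  d s = A * A + + 2 - sq s - sq (star s)

  -- For j² = s²i² the product is i⁴ (D s² - (1 + s²)²), and dividing (1 + s²)² by s² gives s² + 2 +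
  -- s*².
  FF-act : ∀ s i → F i (act s i) * F (act s i) i ≈ sq s * d s * (sq i * sq i)
  FF-act s i = ≈-trans (≈-reflexive (FF i (act s i)))
    (lincomb₂ (D * sq i - (sq i + sq i) - (sq (act s i) + sq s * sq i)) (sq i * sq i)
      (sq-act s i) (sq-star s) (identity A (sq s) (sq (star s)) (sq i) (sq (act s i))))
    where
    identity : ∀ A s t i j → (A * A + + 4) * (i * j) - (i + j) * (i + j) - s * (A * A + + 2 - s - t) * (i * i) ≡
      ((A * A + + 4) * i - (i + i) - (j + s * i)) * (j - s * i) + i * i * (s * t - 1ℤ)
    identity = solve-∀

  -- The factor `sq s` disappears by Fermat, and the product of all i⁴ is (h!)⁴ ≡ 1 by the square of
  -- Wilson's congruence.
  part-generic : ∀ s → d s ≉ 0ℤ → part s * part (star s) ≈ d s ^ h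
  part-generic s d≉0 = begin
    part s * part (star s) ≈⟨ part-star s ⟩
    ∏ {h} (λ i → Φ i (act s i)) ≈⟨ sum-cong-≋ (λ i → ≈-trans (≈-reflexive (Φ-≉0 i (act s i) (nonzero i))) (FF-act s i)) ⟩
    ∏ (λ i → sq s * d s * (sq i * sq i)) ≈⟨ ∏-scale (sq s * d s) (λ i → sq i * sq i) ⟩
    (sq s * d s) ^ h * ∏ (λ i → sq i * sq i) ≈⟨ *-cong power fourth ⟩
    d s ^ h * 1ℤ ≡⟨ ℤₚ.*-identityʳ (d s ^ h) ⟩
    d s ^ h ∎
    where
    nonzero : ∀ i → F i (act s i) * F (act s i) i ≉ 0ℤ
    nonzero i e = *-≉0 (*-≉0 (sq≉0 s) d≉0) (*-≉0 (sq≉0 i) (sq≉0 i)) (≈-trans (≈-sym (FF-act s i)) e)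
    power : (sq s * d s) ^ h ≈ d s ^ h
    power = ≈-trans (≈-reflexive (^-distribʳ-* (sq s) (d s) h))
      (≈-trans (*-cong (sq-^h s) (≈-refl {d s ^ h})) (≈-reflexive (ℤₚ.*-identityˡ (d s ^ h))))
    fourth : ∏ (λ i → sq i * sq i) ≈ 1ℤ
    fourth = ≈-trans (∑-distrib-+ sq sq) (≈-trans (*-cong ∏sq ∏sq) fact²²≈1)

  -- Every pair F(i, j), F(j, i) with j = `act s i` loses exactly one factor, and the survivor is
  -- -2A times the product of i and j. Both indices run through the half-system, which gives (h!)².
  part-degenerate : ∀ s → d s ≈ 0ℤ → A ≉ 0ℤ → part s * part (star s) ≈ -2A ^ h * (fact * fact)
  part-degenerate s d≈0 A≉0 = begin
    part s * part (star s) ≈⟨ part-star s ⟩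
    ∏ {h} (λ i → Φ i (act s i)) ≈⟨ sum-cong-≋ (λ i → Φ-≈0 A≉0 i (act s i) (zero-product i)) ⟩
    ∏ (λ i → -2A * (val i * val (act s i))) ≈⟨ ∏-scale -2A (λ i → val i * val (act s i)) ⟩
    -2A ^ h * ∏ (λ i → val i * val (act s i)) ≈⟨ *-cong (≈-refl { -2A ^ h }) squares ⟩
    -2A ^ h * (fact * fact) ∎
    where
    zero-product : ∀ i → F i (act s i) * F (act s i) i ≈ 0ℤ
    zero-product i = ≈-trans (FF-act s i) (lincomb₁ (sq s * (sq i * sq i)) d≈0 (identity (sq s) (d s) (sq i)))
      where
      identity : ∀ s d i → s * d * (i * i) - 0ℤ ≡ s * (i * i) * (d - 0ℤ)
      identity = solve-∀
    squares : ∏ (λ i → val i * val (act s i)) ≈ fact * fact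
    squares = ≈-trans (∑-distrib-+ val (val ∘ act s))
      (*-cong (≈-refl {fact}) (≈-sym (sum-act *-commutativeMonoid s val)))

  act-one : ∀ i → act one i ≡ i
  act-one i = sq-injective (≈-trans (sq-act one i)
    (≈-reflexive (≡.trans (≡.cong (_* sq i) sq-one) (ℤₚ.*-identityˡ (sq i)))))

  diagonal : ∀ i → F i (act one i) ≡ - A * sq i
  diagonal i = ≡.trans (≡.cong (F i) (act-one i)) (identity A (val i))
    where
    identity : ∀ A x → x * x - A * x * x - x * x ≡ - A * (x * x)
    identity = solve-∀

  part-one : A ≉ 0ℤ → part one ≈ - (A ^ h)
  part-one A≉0 = begin
    part one ≡⟨ sum-cong-≗ (λ i → ≡.trans (nz-≉0 (nonzero i)) (diagonal i)) ⟩
    ∏ (λ i → - A * sq i) ≈⟨ ∏-scale (- A) sq ⟩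
    (- A) ^ h * ∏ sq ≈⟨ *-cong (≈-refl {(- A) ^ h}) ∏sq ⟩
    (- A) ^ h * (fact * fact) ≡⟨ ≡.cong (λ t → t ^ h * (fact * fact)) (≡.sym (ℤₚ.-1*i≡-i A)) ⟩
    (- 1ℤ * A) ^ h * (fact * fact) ≡⟨ ≡.cong (_* (fact * fact)) (^-distribʳ-* (- 1ℤ) A h) ⟩
    (- 1ℤ) ^ h * A ^ h * (fact * fact) ≈⟨ lincomb₁ (A ^ h) wilson (identity ((- 1ℤ) ^ h) (A ^ h) (fact * fact)) ⟩
    - (A ^ h) ∎
    where
    nonzero : ∀ i → F i (act one i) ≉ 0ℤ
    nonzero i e = *-≉0 (-≉0 A≉0) (sq≉0 i) (≈-trans (≈-reflexive (≡.sym (diagonal i))) e)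
    identity : ∀ e a f → e * a * f - - a ≡ a * (e * f - - 1ℤ)
    identity = solve-∀

  part-one-degenerate : A ≈ 0ℤ → part one ≈ 1ℤ
  part-one-degenerate A≈0 = ≈-trans (≈-reflexive (sum-cong-≗ (λ i → nz-≈0 (vanishes i)))) (sum-replicate-zero h)
    where
    vanishes : ∀ i → F i (act one i) ≈ 0ℤ
    vanishes i = ≈-trans (≈-reflexive (diagonal i)) (lincomb₁ (- sq i) A≈0 (identity A (sq i)))
      where
      identity : ∀ a x → - a * x - 0ℤ ≡ - x * (a - 0ℤ)
      identity = solve-∀

  module Imaginary (s : Fin h) (s²≈-1 : sq s ≈ - 1ℤ) where

    opposite : ∀ i → sq (act s i) ≈ - sq i
    opposite i = lincomb₂ 1ℤ (sq i) (sq-act s i) s²≈-1 (identity (sq (act s i)) (sq s) (sq i))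
      where
      identity : ∀ a s i → a - - i ≡ 1ℤ * (a - s * i) + i * (s - - 1ℤ)
      identity = solve-∀

    -- Multiplying twice by a square root of -1 changes only the sign, which classes ignore. With
    -- the absence of fixed points this makes h even.
    act-involutive : ∀ i → act s (act s i) ≡ i
    act-involutive i = sq-injective (lincomb₂ 1ℤ (- 1ℤ) (opposite (act s i)) (opposite i)
      (identity (sq (act s (act s i))) (sq (act s i)) (sq i)))
      where
      identity : ∀ a b c → a - c ≡ 1ℤ * (a - - b) + - 1ℤ * (b - - c)
      identity = solve-∀

    act-free : ∀ i → i ≢ act s i
    act-free i e = *-≉0 2≉0 (sq≉0 i) (lincomb₁ 1ℤ (≡.subst (λ t → sq t ≈ - sq i) (≡.sym e) (opposite i)) (identity (sq i)))
      where
      identity : ∀ a → + 2 * a - 0ℤ ≡ 1ℤ * (a - - a)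
      identity = solve-∀

    open Involution (act s) act-involutive
    open FixedPointFree act-free

    quarter : ℕ
    quarter = orbits

    quarter+quarter≡h : quarter ℕ.+ quarter ≡ h
    quarter+quarter≡h = orbits+orbits

    sign^h : (- 1ℤ) ^ h ≡ 1ℤ
    sign^h = ≡.trans (≡.cong ((- 1ℤ) ^_) (≡.sym quarter+quarter≡h))
      (≡.trans (^-double (- 1ℤ) quarter) (ℤₚ.^-zeroˡ quarter))

    fact²≈-1 : fact * fact ≈ - 1ℤ
    fact²≈-1 = ≈-trans (≈-reflexive (≡.sym (≡.trans (≡.cong (_* (fact * fact)) sign^h) (ℤₚ.*-identityˡ (fact * fact))))) wilson

    FF-opposite : ∀ i → F i (act s i) * F (act s i) i ≈ D * (sq i * sq (act s i))
    FF-opposite i = ≈-trans (≈-reflexive (FF i (act s i)))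
      (lincomb₁ (- (sq i + sq (act s i))) (opposite i) (identity D (sq i) (sq (act s i))))
      where
      identity : ∀ D i j → D * (i * j) - (i + j) * (i + j) - D * (i * j) ≡ - (i + j) * (j - - i)
      identity = solve-∀

    private
      value : ∀ w y → (∀ i → Φ i (act s i) ≈ y * (w i * w (act s i))) → part s ≈ y ^ quarter * ∏ w
      value w y e = ≡.subst (λ t → part s ≈ t * ∏ w) (·≡^ quarter y)
        (sum-weighted-pairs *-commutativeMonoid (λ i → nz (F i (act s i))) w y
          (λ i → ≈-trans (≈-reflexive (≡.cong (λ k → nz (F i (act s i)) * nz (F (act s i) k)) (act-involutive i))) (e i)))

    -- For j = ± si the sum i² + j² vanishes, so F(i, j) F(j, i) is D i² j². Each of the h/2 orbits
    -- contributes one `D`, and the product of all squares is -1.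
    part-imaginary : D ≉ 0ℤ → part s ≈ - (D ^ quarter)
    part-imaginary D≉0 = ≈-trans (value sq D Φ≈)
      (lincomb₂ (D ^ quarter) (D ^ quarter) ∏sq fact²≈-1 (identity (D ^ quarter) (∏ sq) (fact * fact)))
      where
      Φ≈ : ∀ i → Φ i (act s i) ≈ D * (sq i * sq (act s i))
      Φ≈ i = ≈-trans (≈-reflexive (Φ-≉0 i (act s i)
        (λ e → *-≉0 D≉0 (*-≉0 (sq≉0 i) (sq≉0 (act s i))) (≈-trans (≈-sym (FF-opposite i)) e)))) (FF-opposite i)
      identity : ∀ d a f → d * a - - d ≡ d * (a - f) + d * (f - - 1ℤ)
      identity = solve-∀

    -- Now each orbit keeps one of its two factors, namely -2A i j. An index occurs once and not
    -- squared, which is how the factorial itself enters the formula for p dividing A² + 4.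
    part-imaginary-degenerate : D ≈ 0ℤ → A ≉ 0ℤ → part s ≈ -2A ^ quarter * fact
    part-imaginary-degenerate D≈0 A≉0 = value val -2A λ i →
      Φ-≈0 A≉0 i (act s i) (≈-trans (FF-opposite i) (lincomb₁ (sq i * sq (act s i)) D≈0 (identity D (sq i * sq (act s i)))))
      where
      identity : ∀ d x → d * x - 0ℤ ≡ x * (d - 0ℤ)
      identity = solve-∀

-- The product of 1 - t² over t = 2, ..., h.

module Telescope (p : ℕ) (prime : Prime p) (h : ℕ) (p≡ : p ≡ suc (h ℕ.+ h)) where
  open import Data.Integer using (_+_; _*_; -_; _-_; _^_)
  open Products p prime h p≡ public

  -- factor c (t − 1) is c (1 − t²), except that the vanishing factor at t = 1 is replaced by 1.
  factor : ℤ → ℕ → ℤ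
  factor c zero = 1ℤ
  factor c (suc k) = c * (1ℤ - + suc (suc k) * + suc (suc k))

  -- ∏_{t=2}^{n+1} (1 − t)(1 + t) = (−1)^n n! (n + 2)! / 2, with the denominators cleared.
  telescope : ∀ c n → let P = ∏ {suc n} (λ i → + suc (toℕ i)) in
    + 2 * + suc n * c * ∏ {suc n} (factor c ∘ toℕ) ≈ - (c ^ suc n * (- 1ℤ) ^ suc n * (P * P) * + suc (suc n))
  telescope c zero = ≈-reflexive (identity c)
    where
    identity : ∀ c → + 2 * 1ℤ * c * (1ℤ * 1ℤ) ≡ - (c * 1ℤ * (- 1ℤ * 1ℤ) * (1ℤ * 1ℤ * (1ℤ * 1ℤ)) * + 2)
    identity = solve-∀
  telescope c (suc n) = lincomb₃ (+ 2 * (1ℤ + x) * c) (- ((1ℤ + (1ℤ + x)) * (c * e) * (P′ + P * (1ℤ + x)))) (- (c * ((1ℤ + x) * (1ℤ + (1ℤ + x)))))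
    (sum-snoc (suc n) (factor c)) (sum-snoc (suc n) (λ i → + suc i)) (telescope c n)
    (≡.trans (≡.cong (λ t → + 2 * (1ℤ + x) * c * W′ - - (t * (P′ * P′) * (1ℤ + (1ℤ + x)))) (signs c (c ^ suc n) ((- 1ℤ) ^ suc n)))
      (identity x c e W W′ P P′))
    where
    x = + suc n
    e = c ^ suc n * (- 1ℤ) ^ suc n
    W = ∏ {suc n} (factor c ∘ toℕ)
    W′ = ∏ {suc (suc n)} (factor c ∘ toℕ)
    P = ∏ {suc n} (λ i → + suc (toℕ i))
    P′ = ∏ {suc (suc n)} (λ i → + suc (toℕ i))
    signs : ∀ c a b → c * a * (- 1ℤ * b) ≡ - (c * (a * b))
    signs = solve-∀
    identity : ∀ x c e W W′ P P′ →
      + 2 * (1ℤ + x) * c * W′ - - (- (c * e) * (P′ * P′) * (1ℤ + (1ℤ + x))) ≡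
      + 2 * (1ℤ + x) * c * (W′ - W * (c * (1ℤ - (1ℤ + x) * (1ℤ + x)))) +
      - ((1ℤ + (1ℤ + x)) * (c * e) * (P′ + P * (1ℤ + x))) * (P′ - P * (1ℤ + x)) +
      - (c * ((1ℤ + x) * (1ℤ + (1ℤ + x)))) * (+ 2 * x * c * W - - (e * (P * P) * (1ℤ + x)))
    identity = solve-∀

  1+2h≈0 : 1ℤ + (+ h + + h) ≈ 0ℤ
  1+2h≈0 = by 1ℤ (≡.trans (ℤₚ.+-identityʳ (+ suc (h ℕ.+ h))) (≡.trans (≡.cong +_ (≡.sym p≡)) (≡.sym (ℤₚ.*-identityˡ (+ p)))))

  -- At full length Wilson's congruence removes the factorials, and 2h ≡ -1 means h + 1 ≡ -h, so
  -- that h cancels from both sides.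
  twice-∏factor : ∀ c → + 2 * c * ∏ {h} (factor c ∘ toℕ) ≈ - (c ^ h)
  twice-∏factor c = cancelˡ h≉0
    (lincomb₃ 1ℤ (- (c ^ h * (1ℤ + + h))) (c ^ h) (at-h h 0<h) wilson 1+2h≈0
      (identity (+ h) c W (c ^ h) ((- 1ℤ) ^ h) (fact * fact)))
    where
    W = ∏ {h} (factor c ∘ toℕ)
    at-h : ∀ n → 0 ℕ.< n → let P = ∏ {n} (λ i → + suc (toℕ i)) in
      + 2 * + n * c * ∏ {n} (factor c ∘ toℕ) ≈ - (c ^ n * (- 1ℤ) ^ n * (P * P) * + suc n)
    at-h (suc n) _ = telescope c n
    identity : ∀ x c w y e f → x * (+ 2 * c * w) - x * - y ≡
      1ℤ * (+ 2 * x * c * w - - (y * e * f * (1ℤ + x))) + - (y * (1ℤ + x)) * (e * f - - 1ℤ) + y * (1ℤ + (x + x) - 0ℤ)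
    identity = solve-∀
    h≉0 : + h ≉ 0ℤ
    h≉0 e = 1≉0 (lincomb₂ 1ℤ (- + 2) 1+2h≈0 e (identity′ (+ h)))
      where
      identity′ : ∀ x → 1ℤ - 0ℤ ≡ 1ℤ * (1ℤ + (x + x) - 0ℤ) + - + 2 * (x - 0ℤ)
      identity′ = solve-∀

-- The case of α in the prime field.

module Split (p : ℕ) (prime : Prime p) (h : ℕ) (p≡ : p ≡ suc (h ℕ.+ h)) (A : ℤ)
             (α : ℤ) (α² : Congruence._≈_ p (α ℤ.* α) (A ℤ.* α ℤ.+ 1ℤ)) where
  open import Data.Integer using (_+_; _*_; -_; _-_; _^_)
  open Parts p prime h p≡ A public
  open Telescope p prime h p≡ using (factor; twice-∏factor)
  open import Relation.Binary.Reasoning.Setoid setoid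

  β δ : ℤ
  β = A - α
  δ = α - β

  αβ≈-1 : α * β ≈ - 1ℤ
  αβ≈-1 = lincomb₁ (- 1ℤ) α² (identity A α)
    where
    identity : ∀ A α → α * (A - α) - - 1ℤ ≡ - 1ℤ * (α * α - (A * α + 1ℤ))
    identity = solve-∀

  δ²≈D : δ * δ ≈ D
  δ²≈D = lincomb₁ (+ 4) α² (identity A α)
    where
    identity : ∀ A α → (α - (A - α)) * (α - (A - α)) - (A * A + + 4) ≡ + 4 * (α * α - (A * α + 1ℤ))
    identity = solve-∀

  α≉0 : α ≉ 0ℤ
  α≉0 e = 1≉0 (lincomb₂ 1ℤ (- β) αβ≈-1 e (identity α β))
    where
    identity : ∀ α β → 1ℤ - 0ℤ ≡ 1ℤ * (α * β - - 1ℤ) + - β * (α - 0ℤ)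
    identity = solve-∀

  β≉0 : β ≉ 0ℤ
  β≉0 e = 1≉0 (lincomb₂ 1ℤ (- α) αβ≈-1 e (identity α β))
    where
    identity : ∀ α β → 1ℤ - 0ℤ ≡ 1ℤ * (α * β - - 1ℤ) + - α * (β - 0ℤ)
    identity = solve-∀

  abstract
    -- The class of ± α. As β = -1/α, the equation α + s²β = 0 says s² = α².
    a : Fin h
    a = proj₁ (representative α α≉0)

    sq-a : sq a ≈ α * α
    sq-a = proj₂ (representative α α≉0)

  L : Fin h → ℤ
  L s = α + sq s * β

  L-root : ∀ s → L s ≈ 0ℤ → s ≡ a
  L-root s e = sq-injective (≈-trans (lincomb₂ (sq s) (- α) αβ≈-1 e (identity α β (sq s))) (≈-sym sq-a))
    where
    identity : ∀ α β s → s - α * α ≡ s * (α * β - - 1ℤ) + - α * (α + s * β - 0ℤ)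
    identity = solve-∀

  L-a : L a ≈ 0ℤ
  L-a = lincomb₂ β α sq-a αβ≈-1 (identity α β (sq a))
    where
    identity : ∀ α β s → α + s * β - 0ℤ ≡ β * (s - α * α) + α * (α * β - - 1ℤ)
    identity = solve-∀

  d≈LL : ∀ s → d s ≈ L s * L (star s)
  d≈LL s = lincomb₂ (+ 2 - (sq s + sq (star s))) (- (β * β)) αβ≈-1 (sq-star s) (identity A α (sq s) (sq (star s)))
    where
    identity : ∀ A α s t → A * A + + 2 - s - t - (α + s * (A - α)) * (α + t * (A - α)) ≡
      (+ 2 - (s + t)) * (α * (A - α) - - 1ℤ) + - ((A - α) * (A - α)) * (s * t - 1ℤ)
    identity = solve-∀

  A≈0⇒a≡one : A ≈ 0ℤ → a ≡ one
  A≈0⇒a≡one e = sq≈1⇒one (lincomb₃ 1ℤ 1ℤ α sq-a α² e (identity A α (sq a)))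
    where
    identity : ∀ A α s → s - 1ℤ ≡ 1ℤ * (s - α * α) + 1ℤ * (α * α - (A * α + 1ℤ)) + α * (A - 0ℤ)
    identity = solve-∀

  a≡one⇒α²≈1 : a ≡ one → α * α ≈ 1ℤ
  a≡one⇒α²≈1 e = ≈-trans (≈-sym sq-a) (≈-reflexive (≡.trans (≡.cong sq e) sq-one))

  a≡one⇒A≈0 : a ≡ one → A ≈ 0ℤ
  a≡one⇒A≈0 e = cancelˡ α≉0 (lincomb₂ (- 1ℤ) 1ℤ α² (a≡one⇒α²≈1 e) (identity A α))
    where
    identity : ∀ A α → α * A - α * 0ℤ ≡ - 1ℤ * (α * α - (A * α + 1ℤ)) + 1ℤ * (α * α - 1ℤ)
    identity = solve-∀

  D≈0⇒δ≈0 : D ≈ 0ℤ → δ ≈ 0ℤ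
  D≈0⇒δ≈0 e = [ id , id ]′ (integral {δ} {δ} (≈-trans δ²≈D e))

  D≈0⇒α²≈-1 : D ≈ 0ℤ → α * α ≈ - 1ℤ
  D≈0⇒α²≈-1 e = lincomb₂ α 1ℤ (D≈0⇒δ≈0 e) αβ≈-1 (identity α β)
    where
    identity : ∀ α β → α * α - - 1ℤ ≡ α * (α - β - 0ℤ) + 1ℤ * (α * β - - 1ℤ)
    identity = solve-∀

  -- L vanishes exactly at a; the free value v there absorbs the zero factors omitted from T.
  G : ℤ → Fin h → ℤ
  G v = (λ s → L s ^ h) [ a ≔ v ]

  module Assembly (v : ℤ)
    (v-one : a ≡ one → v ≈ - 1ℤ)
    (v-imaginary : sq a ≈ - 1ℤ → part a ≈ - v)
    (v-pair : a ≢ star a → -2A ^ h * (fact * fact) ≈ v * L (star a) ^ h) where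

    private
      G-off : ∀ {s} → s ≢ a → G v s ≡ L s ^ h
      G-off = ≔-off (λ s → L s ^ h) v

      pair-a : a ≢ star a → part a * part (star a) ≈ G v a * G v (star a)
      pair-a a≢ = begin
        part a * part (star a) ≈⟨ part-degenerate a d≈0 (λ A≈0 → a≢ (≡.subst (λ t → t ≡ star t) (≡.sym (A≈0⇒a≡one A≈0)) star-one)) ⟩
        -2A ^ h * (fact * fact) ≈⟨ v-pair a≢ ⟩
        v * L (star a) ^ h ≡⟨ ≡.cong₂ _*_ (≔-at (λ s → L s ^ h) a v) (G-off (a≢ ∘ ≡.sym)) ⟨
        G v a * G v (star a) ∎
        where
        d≈0 : d a ≈ 0ℤ
        d≈0 = ≈-trans (d≈LL a) (*-cong L-a (≈-refl {L (star a)}))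

      pairs : ∀ s → s ≢ star s → part s * part (star s) ≈ G v s * G v (star s)
      pairs s s≢ = cases (s ≟ a) (star s ≟ a)
       where
       cases : Dec (s ≡ a) → Dec (star s ≡ a) → part s * part (star s) ≈ G v s * G v (star s)
       cases (yes e) _ = ≡.subst (λ t → part t * part (star t) ≈ G v t * G v (star t)) (≡.sym e)
                          (pair-a (λ f → s≢ (≡.trans e (≡.trans f (≡.cong star (≡.sym e))))))
       cases (no _) (yes e) = begin
        part s * part (star s) ≡⟨ ℤₚ.*-comm (part s) (part (star s)) ⟩
        part (star s) * part s ≡⟨ ≡.cong₂ (λ t u → part t * part u) e s≡ ⟩
        part a * part (star a) ≈⟨ pair-a (λ f → s≢ (≡.trans s≡ (≡.trans (≡.sym f) (≡.sym e)))) ⟩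
        G v a * G v (star a) ≡⟨ ≡.cong₂ (λ t u → G v t * G v u) e s≡ ⟨
        G v (star s) * G v s ≡⟨ ℤₚ.*-comm (G v (star s)) (G v s) ⟩
        G v s * G v (star s) ∎
        where
        s≡ : s ≡ star a
        s≡ = ≡.trans (≡.sym (star-involutive s)) (≡.cong star e)
       cases (no s≢a) (no s*≢a) = begin
        part s * part (star s) ≈⟨ part-generic s (λ e → *-≉0 (s≢a ∘ L-root s) (s*≢a ∘ L-root (star s)) (≈-trans (≈-sym (d≈LL s)) e)) ⟩
        d s ^ h ≈⟨ ^-cong h (d≈LL s) ⟩
        (L s * L (star s)) ^ h ≡⟨ ^-distribʳ-* (L s) (L (star s)) h ⟩
        L s ^ h * L (star s) ^ h ≡⟨ ≡.cong₂ _*_ (G-off s≢a) (G-off s*≢a) ⟨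
        G v s * G v (star s) ∎

      part-at-one : part one ≈ - G v one
      part-at-one = cases (a ≟ one)
       where
       cases : Dec (a ≡ one) → part one ≈ - G v one
       cases (yes e) = ≈-trans (part-one-degenerate (a≡one⇒A≈0 e)) (≈-sym (-‿cong
              (≈-trans (≈-reflexive (≡.trans (≡.cong (G v) (≡.sym e)) (≔-at (λ s → L s ^ h) a v))) (v-one e))))
       cases (no a≢1) = ≈-trans (part-one (a≢1 ∘ A≈0⇒a≡one)) (≈-reflexive (≡.cong -_
              (≡.trans (≡.cong (_^ h) (≡.trans (identity A α) (≡.cong (λ t → α + t * β) (≡.sym sq-one)))) (≡.sym (G-off (a≢1 ∘ ≡.sym))))))
        where
        identity : ∀ A α → A ≡ α + 1ℤ * (A - α)
        identity = solve-∀

      imaginary : ∀ s → sq s ≈ - 1ℤ → part s ≈ - G v s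
      imaginary s s²≈-1 = cases (s ≟ a)
       where
       cases : Dec (s ≡ a) → part s ≈ - G v s
       cases (yes e) = ≡.subst (λ t → part t ≈ - G v t) (≡.sym e)
         (≈-trans (v-imaginary (≡.subst (λ t → sq t ≈ - 1ℤ) e s²≈-1)) (≈-reflexive (≡.cong -_ (≡.sym (≔-at (λ s → L s ^ h) a v)))))
       cases (no s≢a) = ≈-trans (part-imaginary D≉0) (-‿cong (begin
        D ^ quarter ≈⟨ ^-cong quarter δ²≈D ⟨
        (δ * δ) ^ quarter ≡⟨ ^-double δ quarter ⟨
        δ ^ (quarter ℕ.+ quarter) ≡⟨ ≡.cong (δ ^_) quarter+quarter≡h ⟩
        δ ^ h ≈⟨ ^-cong h (lincomb₁ (- β) s²≈-1 (identity α β (sq s))) ⟩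
        L s ^ h ≡⟨ G-off s≢a ⟨
        G v s ∎))
        where
        open Imaginary s s²≈-1
        D≉0 : D ≉ 0ℤ
        D≉0 e = s≢a (sq-injective (≈-trans s²≈-1 (≈-trans (≈-sym (D≈0⇒α²≈-1 e)) (≈-sym sq-a))))
        identity : ∀ α β s → α - β - (α + s * β) ≡ - β * (s - - 1ℤ)
        identity = solve-∀

      fixes : ∀ s → s ≡ star s → part s ≈ - G v s
      fixes s e = [ (λ s²≈1 → ≡.subst (λ t → part t ≈ - G v t) (≡.sym (sq≈1⇒one s²≈1)) part-at-one) ,
                    imaginary s ]′ (fixed-square e)

    -- The three conditions on `v` cover the possible positions of `a` under inversion: a = 1, a² =
    -- -1, and a different from its inverse. A sign -1 in front of every term is harmless on pairs
    -- and is exactly what the fixed classes require.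
    T≈∏G : T p A ≈ (- 1ℤ) ^ h * ∏ (G v)
    T≈∏G = begin
      T p A ≈⟨ T≈∏part ⟩
      ∏ part ≈⟨ Star.sum-pairs-cong part (λ s → - 1ℤ * G v s)
                  (λ s s≢ → ≈-trans (pairs s s≢) (≈-reflexive (identity (G v s) (G v (star s)))))
                  (λ s e → ≈-trans (fixes s e) (≈-reflexive (≡.sym (ℤₚ.-1*i≡-i (G v s))))) ⟩
      ∏ (λ s → - 1ℤ * G v s) ≈⟨ ∏-scale (- 1ℤ) (G v) ⟩
      (- 1ℤ) ^ h * ∏ (G v) ∎
      where
      identity : ∀ x y → x * y ≡ - 1ℤ * x * (- 1ℤ * y)
      identity = solve-∀

  Q : ℤ
  Q = ∏ (L [ a ≔ 1ℤ ])

  ∏G≈vQ^h : ∀ v → ∏ (G v) ≈ v * Q ^ h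
  ∏G≈vQ^h v = ≈-trans (sum-≔ (λ s → L s ^ h) a v) (*-cong (≈-refl {v})
    (≈-trans (≈-reflexive (sum-cong-≗ same)) (∏-^ h (L [ a ≔ 1ℤ ]))))
    where
    same : ∀ s → ((λ s → L s ^ h) [ a ≔ 1ℤ ]) s ≡ (L [ a ≔ 1ℤ ]) s ^ h
    same s with s ≟ a
    ... | yes _ = ≡.sym (ℤₚ.^-zeroˡ h)
    ... | no _ = ≡.refl

  -- Substituting s = a t turns α + s²β into α (1 − t²).
  2αQ≈-α^h : + 2 * α * Q ≈ - (α ^ h)
  2αQ≈-α^h = ≈-trans (*-cong (≈-refl {+ 2 * α})
      (≈-trans (sum-act *-commutativeMonoid a (L [ a ≔ 1ℤ ])) (sum-cong-≋ substituted)))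
    (twice-∏factor α)
    where
    act-a-one : act a one ≡ a
    act-a-one = sq-injective (≈-trans (sq-act a one) (≈-reflexive (≡.trans (≡.cong (sq a *_) sq-one) (ℤₚ.*-identityʳ (sq a)))))
    L-act : ∀ t → L (act a t) ≈ α * (1ℤ - sq t)
    L-act t = lincomb₃ β (sq t * β) (sq t * α) (sq-act a t) sq-a αβ≈-1 (identity α β (sq a) (sq t) (sq (act a t)))
      where
      identity : ∀ α β a t u → α + u * β - α * (1ℤ - t) ≡
        β * (u - a * t) + t * β * (a - α * α) + t * α * (α * β - - 1ℤ)
      identity = solve-∀
    substituted : ∀ t → (L [ a ≔ 1ℤ ]) (act a t) ≈ factor α (toℕ t)
    substituted t with t ≟ one | toℕ t in e
    ... | yes t≡1 | zero = ≈-reflexive (≡.trans (≡.cong (λ i → (L [ a ≔ 1ℤ ]) (act a i)) t≡1)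
                             (≡.trans (≡.cong (L [ a ≔ 1ℤ ]) act-a-one) (≔-at L a 1ℤ)))
    ... | yes t≡1 | suc k = ⊥-elim (ℕₚ.0≢1+n (≡.trans (≡.sym toℕ-one) (≡.trans (≡.cong toℕ (≡.sym t≡1)) e)))
    ... | no t≢1 | zero = ⊥-elim (t≢1 (Finₚ.toℕ-injective (≡.trans e (≡.sym toℕ-one))))
    ... | no t≢1 | suc k = ≈-trans (≈-reflexive (≔-off L 1ℤ off)) (≈-trans (L-act t)
                             (≈-reflexive (≡.cong (λ i → α * (1ℤ - + suc i * + suc i)) e)))
      where
      off : act a t ≢ a
      off f = t≢1 (sq≈1⇒one (cancelˡ (sq≉0 a)
        (≈-trans (≈-sym (sq-act a t)) (≈-reflexive (≡.trans (≡.cong sq f) (≡.sym (ℤₚ.*-identityʳ (sq a))))))))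

  -- Since 1/α = -β, the value of 2αQ gives 2Q ≡ βα^h. The choice of `v` supplies the missing 2δβ
  -- inside the h-th power, whose base becomes β² δ α^h; Fermat removes β².
  T-split : D ≉ 0ℤ → T p A ≈ - (δ ^ h * (α ^ h) ^ h)
  T-split D≉0 = begin
    T p A ≈⟨ T≈∏G ⟩
    (- 1ℤ) ^ h * ∏ (G v) ≈⟨ *-cong (≈-refl {(- 1ℤ) ^ h}) (∏G≈vQ^h v) ⟩
    (- 1ℤ) ^ h * (- (X ^ h) * Q ^ h) ≡⟨ regroup ((- 1ℤ) ^ h) (X ^ h) (Q ^ h) ⟩
    - ((- 1ℤ) ^ h * X ^ h * Q ^ h) ≡⟨ ≡.cong (λ t → - (t * Q ^ h)) (^-distribʳ-* (- 1ℤ) X h) ⟨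
    - ((- 1ℤ * X) ^ h * Q ^ h) ≡⟨ ≡.cong -_ (^-distribʳ-* (- 1ℤ * X) Q h) ⟨
    - ((- 1ℤ * X * Q) ^ h) ≈⟨ -‿cong (^-cong h
         (lincomb₂ (- (δ * β * β)) (+ 2 * δ * β * Q) 2αQ≈-α^h αβ≈-1 (identity δ α β Q (α ^ h)))) ⟩
    - ((β * β * (δ * α ^ h)) ^ h) ≡⟨ ≡.cong -_ (^-distribʳ-* (β * β) (δ * α ^ h) h) ⟩
    - ((β * β) ^ h * (δ * α ^ h) ^ h) ≈⟨ -‿cong (*-cong (fermat β≉0) (≈-refl {(δ * α ^ h) ^ h})) ⟩
    - (1ℤ * (δ * α ^ h) ^ h) ≡⟨ ≡.cong -_ (≡.trans (ℤₚ.*-identityˡ ((δ * α ^ h) ^ h)) (^-distribʳ-* δ (α ^ h) h)) ⟩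
    - (δ ^ h * (α ^ h) ^ h) ∎
    where
    -- v is forced by the pair {a, star a}, since L (star a) ≡ − A δ β.
    X v : ℤ
    X = - (+ 2 * δ * β)
    v = - (X ^ h)
    regroup : ∀ e x q → e * (- x * q) ≡ - (e * x * q)
    regroup = solve-∀
    identity : ∀ δ α β q x → - 1ℤ * - (+ 2 * δ * β) * q - β * β * (δ * x) ≡
      - (δ * β * β) * (+ 2 * α * q - - x) + + 2 * δ * β * q * (α * β - - 1ℤ)
    identity = solve-∀
    δ≉0 : δ ≉ 0ℤ
    δ≉0 e = D≉0 (≈-trans (≈-sym δ²≈D) (≈-trans (*-cong e (≈-refl {δ})) (≈-reflexive (ℤₚ.*-zeroˡ δ))))
    v-one : a ≡ one → v ≈ - 1ℤ
    v-one e = -‿cong (≈-trans (^-cong h X≈4) (fermat 2≉0))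
      where
      -- From α² = 1 and αβ = -1 follow β = -α and δ = 2α, so X = 4α².
      X≈4 : X ≈ + 2 * + 2
      X≈4 = lincomb₂ (+ 2 * (α * β - + 2)) (- (+ 2 * (β * β))) αβ≈-1 (a≡one⇒α²≈1 e) (identity′ α β)
        where
        identity′ : ∀ α β → - (+ 2 * (α - β) * β) - + 2 * + 2 ≡
          + 2 * (α * β - + 2) * (α * β - - 1ℤ) + - (+ 2 * (β * β)) * (α * α - 1ℤ)
        identity′ = solve-∀
    -- This position is impossible: α² = -1 = αβ would force α = β.
    v-imaginary : sq a ≈ - 1ℤ → part a ≈ - v
    v-imaginary e = ⊥-elim (δ≉0 (cancelˡ α≉0 (lincomb₃ 1ℤ (- 1ℤ) (- 1ℤ) e sq-a αβ≈-1 (identity′ α β (sq a)))))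
      where
      identity′ : ∀ α β s → α * (α - β) - α * 0ℤ ≡ 1ℤ * (s - - 1ℤ) + - 1ℤ * (s - α * α) + - 1ℤ * (α * β - - 1ℤ)
      identity′ = solve-∀
    sq-star-a : sq (star a) ≈ β * β
    sq-star-a = cancelˡ (sq≉0 a) (lincomb₃ 1ℤ (- (β * β)) (- (α * β - 1ℤ)) (sq-star a) sq-a αβ≈-1 (identity′ α β (sq a) (sq (star a))))
      where
      identity′ : ∀ α β s t → s * t - s * (β * β) ≡ 1ℤ * (s * t - 1ℤ) + - (β * β) * (s - α * α) + - (α * β - 1ℤ) * (α * β - - 1ℤ)
      identity′ = solve-∀
    L-star-a : L (star a) ≈ - (A * δ * β)
    L-star-a = lincomb₂ β α sq-star-a αβ≈-1 (identity′ A α (sq (star a)))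
      where
      identity′ : ∀ A α t → α + t * (A - α) - - (A * (α - (A - α)) * (A - α)) ≡
        (A - α) * (t - (A - α) * (A - α)) + α * (α * (A - α) - - 1ℤ)
      identity′ = solve-∀
    -- The square (δβ)², whose h-th power is 1, is inserted so that 2A(δβ)² splits into `X` and the
    -- value -Aδβ of `L (star a)`.
    v-pair : a ≢ star a → -2A ^ h * (fact * fact) ≈ v * L (star a) ^ h
    v-pair _ = begin
      -2A ^ h * (fact * fact) ≡⟨ ≡.cong (λ t → t ^ h * (fact * fact)) (≡.sym (ℤₚ.-1*i≡-i (+ 2 * A))) ⟩
      (- 1ℤ * (+ 2 * A)) ^ h * (fact * fact) ≡⟨ ≡.cong (_* (fact * fact)) (^-distribʳ-* (- 1ℤ) (+ 2 * A) h) ⟩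
      (- 1ℤ) ^ h * (+ 2 * A) ^ h * (fact * fact)
        ≈⟨ lincomb₂ ((+ 2 * A) ^ h) ((+ 2 * A) ^ h) wilson (fermat (*-≉0 δ≉0 β≉0)) (identity₁ ((- 1ℤ) ^ h) ((+ 2 * A) ^ h) (fact * fact) ((δ * β * (δ * β)) ^ h)) ⟩
      - ((+ 2 * A) ^ h * (δ * β * (δ * β)) ^ h) ≡⟨ ≡.cong -_ (^-distribʳ-* (+ 2 * A) (δ * β * (δ * β)) h) ⟨
      - ((+ 2 * A * (δ * β * (δ * β))) ^ h) ≡⟨ ≡.cong (λ t → - (t ^ h)) (identity₂ A δ β) ⟩
      - ((X * - (A * δ * β)) ^ h) ≡⟨ ≡.cong -_ (^-distribʳ-* X (- (A * δ * β)) h) ⟩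
      - (X ^ h * (- (A * δ * β)) ^ h) ≡⟨ ℤₚ.neg-distribˡ-* (X ^ h) ((- (A * δ * β)) ^ h) ⟩
      v * (- (A * δ * β)) ^ h ≈⟨ *-cong (≈-refl {v}) (^-cong h L-star-a) ⟨
      v * L (star a) ^ h ∎
      where
      identity₁ : ∀ e x f y → e * x * f - - (x * y) ≡ x * (e * f - - 1ℤ) + x * (y - 1ℤ)
      identity₁ = solve-∀
      identity₂ : ∀ A δ β → + 2 * A * (δ * β * (δ * β)) ≡ - (+ 2 * δ * β) * - (A * δ * β)
      identity₂ = solve-∀
    open Assembly v v-one v-imaginary v-pair

  -- A double root has α² = αβ = -1, so the vanishing class is the self-paired class with s² = -1,
  -- and `v` is minus the product of its surviving factors. With A = 2α and h = 2m the power of -2A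
  -- splits into (-1)^m, 4^m = 2^h and α^m; the first two cancel against Q^h, because 2αQ ≡ -(-1)^m
  -- and h is even.
  T-double-root : D ≈ 0ℤ → ∃ λ m → m ℕ.+ m ≡ h × T p A ≈ - (α ^ m * fact)
  T-double-root D≈0 = m , quarter+quarter≡h , (begin
    T p A ≈⟨ T≈∏G ⟩
    (- 1ℤ) ^ h * ∏ (G v) ≡⟨ ≡.trans (≡.cong (_* ∏ (G v)) sign^h) (ℤₚ.*-identityˡ (∏ (G v))) ⟩
    ∏ (G v) ≈⟨ ∏G≈vQ^h v ⟩
    - (-2A ^ m * fact) * Q ^ h ≈⟨ *-cong (-‿cong (*-cong -2A^m (≈-refl {fact}))) (≈-refl {Q ^ h}) ⟩
    - (ε * 2^h * α ^ m * fact) * Q ^ h ≈⟨ lincomb₁ (- (α ^ m * fact)) Q^h (regroup ε 2^h (α ^ m) fact (Q ^ h)) ⟩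
    - (α ^ m * fact) ∎)
    where
    sq-a≈-1 : sq a ≈ - 1ℤ
    sq-a≈-1 = ≈-trans sq-a (D≈0⇒α²≈-1 D≈0)
    open Imaginary a sq-a≈-1
    m : ℕ
    m = quarter
    ε 2^h v : ℤ
    ε = (- 1ℤ) ^ m
    2^h = (+ 2 * + 2) ^ m
    v = - (-2A ^ m * fact)
    1≉-1 : 1ℤ ≉ - 1ℤ
    1≉-1 e = 2≉0 (lincomb₁ 1ℤ e ≡.refl)
    regroup : ∀ e t x f q → - (e * t * x * f) * q - - (x * f) ≡ - (x * f) * (t * e * q - 1ℤ)
    regroup = solve-∀
    a≢one : a ≢ one
    a≢one e = 1≉-1 (≈-trans (≈-reflexive (≡.trans (≡.sym sq-one) (≡.cong sq (≡.sym e)))) sq-a≈-1)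
    a≡star-a : a ≡ star a
    a≡star-a = star-unique (*-cong sq-a≈-1 sq-a≈-1)
    open Assembly v (λ e → ⊥-elim (a≢one e))
      (λ _ → ≈-trans (part-imaginary-degenerate D≈0 (a≢one ∘ A≈0⇒a≡one)) (≈-reflexive (≡.sym (ℤₚ.neg-involutive (-2A ^ m * fact)))))
      (λ a≢ → ⊥-elim (a≢ a≡star-a))
    -2A^m : -2A ^ m ≈ ε * 2^h * α ^ m
    -2A^m = begin
      -2A ^ m ≈⟨ ^-cong m (lincomb₁ (+ 2) (D≈0⇒δ≈0 D≈0) (identity A α)) ⟩
      (- 1ℤ * (+ 2 * + 2) * α) ^ m ≡⟨ ^-distribʳ-* (- 1ℤ * (+ 2 * + 2)) α m ⟩
      (- 1ℤ * (+ 2 * + 2)) ^ m * α ^ m ≡⟨ ≡.cong (_* α ^ m) (^-distribʳ-* (- 1ℤ) (+ 2 * + 2) m) ⟩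
      ε * 2^h * α ^ m ∎
      where
      identity : ∀ A α → - (+ 2 * A) - - 1ℤ * (+ 2 * + 2) * α ≡ + 2 * (α - (A - α) - 0ℤ)
      identity = solve-∀
    α^h≈ε : α ^ h ≈ ε
    α^h≈ε = ≈-trans (≈-reflexive (≡.trans (≡.cong (α ^_) (≡.sym quarter+quarter≡h)) (^-double α m)))
      (^-cong m (D≈0⇒α²≈-1 D≈0))
    ε^h≡1 : ε ^ h ≡ 1ℤ
    ε^h≡1 = ≡.trans (ℤₚ.^-*-assoc (- 1ℤ) m h) (≡.trans (≡.cong ((- 1ℤ) ^_) (ℕₚ.*-comm m h))
      (≡.trans (≡.sym (ℤₚ.^-*-assoc (- 1ℤ) h m)) (≡.trans (≡.cong (_^ m) sign^h) (ℤₚ.^-zeroˡ m))))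
    Q^h : 2^h * ε * Q ^ h ≈ 1ℤ
    Q^h = begin
      2^h * ε * Q ^ h ≡⟨ ≡.cong (λ t → t * ε * Q ^ h) (≡.trans (≡.sym (^-double (+ 2) m)) (≡.cong ((+ 2) ^_) quarter+quarter≡h)) ⟩
      (+ 2) ^ h * ε * Q ^ h ≈⟨ *-cong (*-cong (≈-refl {(+ 2) ^ h}) (≈-sym α^h≈ε)) (≈-refl {Q ^ h}) ⟩
      (+ 2) ^ h * α ^ h * Q ^ h ≡⟨ ≡.trans (≡.cong (_* Q ^ h) (≡.sym (^-distribʳ-* (+ 2) α h))) (≡.sym (^-distribʳ-* (+ 2 * α) Q h)) ⟩
      (+ 2 * α * Q) ^ h ≈⟨ ^-cong h (≈-trans 2αQ≈-α^h (-‿cong α^h≈ε)) ⟩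
      (- ε) ^ h ≡⟨ ≡.cong (_^ h) (≡.sym (ℤₚ.-1*i≡-i ε)) ⟩
      (- 1ℤ * ε) ^ h ≡⟨ ^-distribʳ-* (- 1ℤ) ε h ⟩
      (- 1ℤ) ^ h * ε ^ h ≡⟨ ≡.cong₂ _*_ sign^h ε^h≡1 ⟩
      1ℤ ∎

-- Monic polynomial functions over a commutative ring with a map from ℤ.

-- The homomorphism ℤ → R supplies the coefficients of the ring solver.
module IntegerAlgebra (R : CommutativeRing 0ℓ 0ℓ)
  (embedding : ℤ.+-*-rawRing -Raw-AlmostCommutative⟶ fromCommutativeRing R) where

  open CommutativeRing R public hiding (zero)
  open _-Raw-AlmostCommutative⟶_ embedding public renaming (⟦_⟧ to ι)

  private
    coefficient-equality : ∀ a b → Maybe (ι a ≈ ι b)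
    coefficient-equality a b with a ℤ.≟ b
    ... | yes e = just (reflexive (≡.cong ι e))
    ... | no _ = nothing

  open RingSolver ℤ.+-*-rawRing (fromCommutativeRing R) embedding coefficient-equality public
    using (solve; con; _:=_; _:+_; _:*_; _:-_; :-_)
  open import Algebra.Properties.CommutativeSemiring.Exp commutativeSemiring public
  open Sum *-commutativeMonoid public using (sum-cong-≋; sum-cong-≗; ∑-distrib-+) renaming (sum to ∏)
  open SumLemmas *-commutativeMonoid public
  open import Relation.Binary.Reasoning.Setoid setoid

  difference : ∀ {x y} → x ≈ y → x - y ≈ 0#
  difference {x} {y} e = trans (+-congʳ e) (-‿inverseʳ y)

  equal : ∀ {x y} → x - y ≈ 0# → x ≈ y
  equal {x} {y} e = trans (solve 2 (λ x y → x := (x :- y) :+ y) refl x y) (trans (+-congʳ e) (+-identityˡ y))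

  combine₁ : ∀ {a b x y} c → a ≈ b → x - y ≈ c * (a - b) → x ≈ y
  combine₁ c e i = equal (trans i (trans (*-congˡ (difference e)) (zeroʳ c)))

  combine₂ : ∀ {a b a′ b′ x y} c d → a ≈ b → a′ ≈ b′ → x - y ≈ c * (a - b) + d * (a′ - b′) → x ≈ y
  combine₂ c d e f i = equal (trans i (trans (+-cong (trans (*-congˡ (difference e)) (zeroʳ c))
    (trans (*-congˡ (difference f)) (zeroʳ d))) (+-identityˡ 0#)))

  ι-∏ : ∀ {n} (f : Fin n → ℤ) → ι (Sum.sum ℤₚ.*-1-commutativeMonoid f) ≈ ∏ (ι ∘ f)
  ι-∏ {zero} f = 1-homo
  ι-∏ {suc n} f = trans (*-homo _ _) (*-congˡ (ι-∏ (f ∘ suc)))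

  ι-^ : ∀ a n → ι (a ℤ.^ n) ≈ ι a ^ n
  ι-^ a zero = 1-homo
  ι-^ a (suc n) = trans (*-homo a (a ℤ.^ n)) (*-congˡ (ι-^ a n))

  ι-minus : ∀ a b → ι (a ℤ.- b) ≈ ι a - ι b
  ι-minus a b = trans (+-homo a (ℤ.- b)) (+-congˡ (-‿homo b))

  1^ : ∀ n → 1# ^ n ≈ 1#
  1^ zero = refl
  1^ (suc n) = trans (*-identityˡ (1# ^ n)) (1^ n)

  -- Monic polynomial functions of a given degree, in Horner form.
  Monic : ℕ → (Carrier → Carrier) → Set
  Monic zero f = ∀ x → f x ≈ 1#
  Monic (suc n) f = ∃ λ g → ∃ λ c → Monic n g × (∀ x → f x ≈ x * g x + c)

  monic-^ : ∀ n → Monic n (_^ n)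
  monic-^ zero x = refl
  monic-^ (suc n) = _ , 0# , monic-^ n , λ x → sym (+-identityʳ (x * x ^ n))

  monic-+ : ∀ {n f} c → 0 ℕ.< n → Monic n f → Monic n (λ x → f x + c)
  monic-+ {suc n} c _ (g , c′ , m , e) = g , c′ + c , m , λ x → trans (+-congʳ (e x)) (+-assoc (x * g x) c′ c)

  monic-* : ∀ {n f} → Monic n f → Monic (suc n) (λ x → x * f x)
  monic-* {f = f} m = f , 0# , m , λ x → sym (+-identityʳ (x * f x))

  -- Synthetic division: if g has quotient q by x - a, then x g + c has quotient x q + g(a).
  divide : ∀ {n f} → Monic (suc n) f → ∀ a → ∃ λ q → Monic n q × (∀ x → f x ≈ (x - a) * q x + f a)
  divide {zero} {f} (g , c , m , e) a = (λ _ → 1#) , (λ _ → refl) , λ x → begin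
    f x ≈⟨ e x ⟩
    x * g x + c ≈⟨ +-congʳ (*-congˡ (trans (m x) (sym (m a)))) ⟩
    x * g a + c ≈⟨ solve 4 (λ x a g c → x :* g :+ c := (x :- a) :* g :+ (a :* g :+ c)) refl x a (g a) c ⟩
    (x - a) * g a + (a * g a + c) ≈⟨ +-cong (*-congˡ (m a)) (sym (e a)) ⟩
    (x - a) * 1# + f a ∎
  divide {suc n} {f} (g , c , m , e) a with divide m a
  ... | q , mq , eq = (λ x → x * q x + g a) , (q , g a , mq , λ _ → refl) , λ x → begin
    f x ≈⟨ e x ⟩
    x * g x + c ≈⟨ +-congʳ (*-congˡ (eq x)) ⟩
    x * ((x - a) * q x + g a) + c
      ≈⟨ solve 5 (λ x a q g c → x :* ((x :- a) :* q :+ g) :+ c := (x :- a) :* (x :* q :+ g) :+ (a :* g :+ c)) refl x a (q x) (g a) c ⟩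
    (x - a) * (x * q x + g a) + (a * g a + c) ≈⟨ +-congˡ (e a) ⟨
    (x - a) * (x * q x + g a) + f a ∎

  -- Regular differences of roots are enough to split a polynomial into linear factors. In the
  -- quadratic extension they are available for integers incongruent modulo p, because an integer
  -- multiplies both coordinates separately.
  Regular : Carrier → Set
  Regular x = ∀ y → x * y ≈ 0# → y ≈ 0#

  -- After one root is divided off, regularity of its difference to each other root makes the latter
  -- a root of the quotient.
  monic-product : ∀ {n f} → Monic n f → (r : Fin n → Carrier) → (∀ i → f (r i) ≈ 0#) →
    (∀ i j → i ≢ j → Regular (r i - r j)) → ∀ x → f x ≈ ∏ (λ i → x - r i)
  monic-product {zero} m r _ _ x = m x
  monic-product {suc n} {f} m r roots regular x with divide m (r zero)
  ... | q , mq , eq = begin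
    f x ≈⟨ eq x ⟩
    (x - r zero) * q x + f (r zero) ≈⟨ trans (+-congˡ (roots zero)) (+-identityʳ _) ⟩
    (x - r zero) * q x ≈⟨ *-congˡ (monic-product mq (r ∘ suc) q-roots
                            (λ i j i≢j → regular (suc i) (suc j) (i≢j ∘ Finₚ.suc-injective)) x) ⟩
    (x - r zero) * ∏ (λ i → x - r (suc i)) ∎
    where
    q-roots : ∀ i → q (r (suc i)) ≈ 0#
    q-roots i = regular (suc i) zero (λ ()) (q (r (suc i))) (begin
      (r (suc i) - r zero) * q (r (suc i)) ≈⟨ trans (+-congˡ (roots zero)) (+-identityʳ _) ⟨
      (r (suc i) - r zero) * q (r (suc i)) + f (r zero) ≈⟨ eq (r (suc i)) ⟨
      f (r (suc i)) ≈⟨ roots (suc i) ⟩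
      0# ∎)

open _-Raw-AlmostCommutative⟶_ using (⟦_⟧)

-- Frobenius identities and Binet's formula in characteristic p.

module Characteristic (p : ℕ) (prime : Prime p) (h : ℕ) (p≡ : p ≡ suc (h ℕ.+ h)) (R : CommutativeRing 0ℓ 0ℓ)
  (embedding : ℤ.+-*-rawRing -Raw-AlmostCommutative⟶ fromCommutativeRing R)
  (ι-cong : ∀ {a b : ℤ} → Congruence._≈_ p a b →
            CommutativeRing._≈_ R (⟦_⟧ embedding a) (⟦_⟧ embedding b))
  (ι-regular : ∀ {a : ℤ} → Congruence._≉_ p a 0ℤ →
               IntegerAlgebra.Regular R embedding (⟦_⟧ embedding a)) where
  open IntegerAlgebra R embedding public
  private module P = Products p prime h p≡
  open P using (sq)
  open import Relation.Binary.Reasoning.Setoid setoid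

  ι-distinct : ∀ {a b} → ¬ a P.≈ b → Regular (ι a - ι b)
  ι-distinct {a} {b} a≉b y e = ι-regular (λ z → a≉b (P.lincomb₁ 1ℤ z (≡.sym (≡.trans (ℤₚ.*-identityˡ (a ℤ.- b ℤ.- 0ℤ)) (ℤₚ.+-identityʳ (a ℤ.- b))))))
    y (trans (*-congʳ (ι-minus a b)) e)

  ∏-squares : ∀ x → x ^ h - 1# ≈ ∏ (λ s → x - ι (sq s))
  ∏-squares = monic-product (monic-+ (- 1#) P.0<h (monic-^ h)) (ι ∘ sq) roots
    (λ i j i≢j → ι-distinct (i≢j ∘ P.sq-injective))
    where
    roots : ∀ s → ι (sq s) ^ h - 1# ≈ 0#
    roots s = difference (trans (sym (ι-^ (sq s) h)) (trans (ι-cong (P.sq-^h s)) 1-homo))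

  private
    rising : ∀ x → x * (x ^ (h ℕ.+ h) - 1#) ≈ ∏ {suc (h ℕ.+ h)} (λ c → x - ι (+ toℕ c))
    rising = monic-product (monic-* (monic-+ (- 1#) (ℕₚ.<-≤-trans P.0<h (ℕₚ.m≤m+n h h)) (monic-^ (h ℕ.+ h))))
      (ι ∘ +_ ∘ toℕ) roots (λ i j i≢j → ι-distinct (λ e → i≢j (Finₚ.toℕ-injective (P.small-≈ (small i) (small j) e))))
      where
      small : ∀ i → toℕ i ℕ.< p
      small i = ≡.subst (toℕ i ℕ.<_) (≡.sym p≡) (Finₚ.toℕ<n i)
      roots : ∀ i → ι (+ toℕ i) * (ι (+ toℕ i) ^ (h ℕ.+ h) - 1#) ≈ 0#
      roots i = cases (+ toℕ i P.≈? 0ℤ)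
        where
        cases : Dec (+ toℕ i P.≈ 0ℤ) → _
        cases (yes z) = trans (*-congʳ (trans (ι-cong z) 0-homo)) (zeroˡ _)
        cases (no nz) = trans (*-congˡ (difference (trans (sym (ι-^ (+ toℕ i) (h ℕ.+ h)))
          (trans (reflexive (≡.cong ι (^-double (+ toℕ i) h))) (trans (ι-cong (P.fermat nz)) 1-homo))))) (zeroʳ _)

    -- Replacing x by x + 1 rotates the factors x − c of x^p − x.
    shift₁ : ∀ x → (x + 1#) ^ suc (h ℕ.+ h) ≈ x ^ suc (h ℕ.+ h) + 1#
    shift₁ x = begin
      (x + 1#) * (x + 1#) ^ m
        ≈⟨ solve 4 (λ x y o z → (x :+ z) :* y := (x :+ z) :* (y :- o) :+ (x :+ z) :* o) refl x ((x + 1#) ^ m) 1# 1# ⟩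
      (x + 1#) * ((x + 1#) ^ m - 1#) + (x + 1#) * 1# ≈⟨ +-cong rotated (trans (*-identityʳ (x + 1#)) (+-congʳ (sym (*-identityʳ x)))) ⟩
      x * (x ^ m - 1#) + (x * 1# + 1#)
        ≈⟨ solve 4 (λ x y o z → x :* (y :- o) :+ (x :* o :+ z) := x :* y :+ z) refl x (x ^ m) 1# 1# ⟩
      x * x ^ m + 1# ∎
      where
      m : ℕ
      m = h ℕ.+ h
      rotated : (x + 1#) * ((x + 1#) ^ m - 1#) ≈ x * (x ^ m - 1#)
      rotated = begin
        (x + 1#) * ((x + 1#) ^ m - 1#) ≈⟨ rising (x + 1#) ⟩
        ((x + 1#) - ι 0ℤ) * ∏ {m} (λ c → (x + 1#) - ι (+ suc (toℕ c)))
          -- The factor for c = 0 becomes the one for c = p - 1, since -1 ≡ 2h; every other index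
          -- drops by one.
          ≈⟨ *-cong (trans (solve 2 (λ x o → (x :+ o) :- con 0ℤ := x :- :- o) refl x 1#) (+-congˡ (-‿cong -1≈m)))
               (sum-cong-≋ {m} (λ c → trans (+-congˡ (-‿cong (trans (+-homo 1ℤ (+ toℕ c)) (+-congʳ 1-homo))))
                 (solve 3 (λ x c o → (x :+ o) :- (o :+ c) := x :- c) refl x (ι (+ toℕ c)) 1#))) ⟩
        (x - ι (+ m)) * ∏ {m} (λ c → x - ι (+ toℕ c)) ≈⟨ *-comm _ _ ⟩
        ∏ {m} (λ c → x - ι (+ toℕ c)) * (x - ι (+ m)) ≈⟨ sum-snoc m (λ c → x - ι (+ c)) ⟨
        ∏ {suc m} (λ c → x - ι (+ toℕ c)) ≈⟨ rising x ⟨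
        x * (x ^ m - 1#) ∎
        where
        -1≈m : - 1# ≈ ι (+ m)
        -1≈m = trans (-‿cong (sym 1-homo)) (trans (sym (-‿homo 1ℤ)) (ι-cong (P.by (ℤ.- 1ℤ)
          (≡.trans (≡.sym (ℤₚ.neg-distrib-+ 1ℤ (+ m))) (≡.trans (≡.cong (λ t → ℤ.- (+ t)) (≡.sym p≡)) (≡.sym (ℤₚ.-1*i≡-i (+ p))))))))

  -- Additivity against integers, obtained by iterating the shift by 1, suffices for the later use
  -- on 2α = δ + A.
  frobenius-shift : ∀ n x → (x + ι (+ n)) ^ p ≈ x ^ p + ι (+ n)
  frobenius-shift n x = ≡.subst (λ q → (x + ι (+ n)) ^ q ≈ x ^ q + ι (+ n)) (≡.sym p≡) (go n)
    where
    m : ℕ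
    m = suc (h ℕ.+ h)
    go : ∀ n → (x + ι (+ n)) ^ m ≈ x ^ m + ι (+ n)
    go zero = trans (^-congˡ m (trans (+-congˡ 0-homo) (+-identityʳ x))) (sym (trans (+-congˡ 0-homo) (+-identityʳ (x ^ m))))
    go (suc n) = begin
      (x + ι (+ suc n)) ^ m ≈⟨ ^-congˡ m (step x) ⟩
      ((x + ι (+ n)) + 1#) ^ m ≈⟨ shift₁ (x + ι (+ n)) ⟩
      (x + ι (+ n)) ^ m + 1# ≈⟨ +-congʳ (go n) ⟩
      (x ^ m + ι (+ n)) + 1# ≈⟨ step (x ^ m) ⟨
      x ^ m + ι (+ suc n) ∎
      where
      step : ∀ y → y + ι (+ suc n) ≈ (y + ι (+ n)) + 1#
      step y = trans (+-congˡ (trans (+-homo 1ℤ (+ n)) (+-congʳ 1-homo)))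
        (solve 3 (λ y c o → y :+ (o :+ c) := (y :+ c) :+ o) refl y (ι (+ n)) 1#)

  -- Both sides satisfy the recurrence of `u`, because α and β are roots of z² = Az + 1. Two
  -- consecutive indices are carried through the induction.
  binet : ∀ A {α β} → α + β ≈ ι A → α * β ≈ ι (ℤ.- 1ℤ) → ∀ n → ι (u n A) * (α - β) ≈ α ^ n - β ^ n
  binet A {α} {β} sum-αβ prod-αβ n = proj₁ (both n)
    where
    both : ∀ n → (ι (u n A) * (α - β) ≈ α ^ n - β ^ n) × (ι (u (suc n) A) * (α - β) ≈ α ^ suc n - β ^ suc n)
    both zero = solve 3 (λ α β o → con 0ℤ :* (α :- β) := o :- o) refl α β 1# ,
      trans (solve 2 (λ α β → con 1ℤ :* (α :- β) := α :- β) refl α β)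
        (+-cong (sym (*-identityʳ α)) (-‿cong (sym (*-identityʳ β))))
    both (suc n) with both n
    ... | e , f = f , (begin
      ι (A ℤ.* u (suc n) A ℤ.+ u n A) * (α - β)
        ≈⟨ *-congʳ (trans (+-homo _ _) (+-congʳ (trans (*-homo A (u (suc n) A)) (*-congʳ (sym sum-αβ))))) ⟩
      ((α + β) * ι (u (suc n) A) + ι (u n A)) * (α - β)
        ≈⟨ solve 4 (λ α β v w → ((α :+ β) :* v :+ w) :* (α :- β) := (α :+ β) :* (v :* (α :- β)) :+ w :* (α :- β)) refl α β (ι (u (suc n) A)) (ι (u n A)) ⟩
      (α + β) * (ι (u (suc n) A) * (α - β)) + ι (u n A) * (α - β) ≈⟨ +-cong (*-congˡ f) e ⟩
      (α + β) * (α * α ^ n - β * β ^ n) + (α ^ n - β ^ n)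
        ≈⟨ combine₁ (α ^ n - β ^ n) prod-αβ (solve 4 (λ α β x y →
             ((α :+ β) :* (α :* x :- β :* y) :+ (x :- y)) :- (α :* (α :* x) :- β :* (β :* y)) :=
             (x :- y) :* (α :* β :- con (ℤ.- 1ℤ))) refl α β (α ^ n) (β ^ n)) ⟩
      α * (α * α ^ n) - β * (β * β ^ n) ∎)


-- Nonvanishing when A² + 4 is a nonresidue.

module Nonresidue (p : ℕ) (prime : Prime p) (h : ℕ) (p≡ : p ≡ suc (h ℕ.+ h)) (A : ℤ)
  (nonresidue : ∀ x → Congruence._≉_ p (x ℤ.* x) (A ℤ.* A ℤ.+ + 4)) where
  open Parts p prime h p≡ A
  open import Data.Integer using (_+_; _*_; -_; _-_)

  A≉0 : A ≉ 0ℤ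
  A≉0 e = nonresidue (+ 2) (lincomb₁ (- A) e (identity A))
    where
    identity : ∀ A → + 2 * + 2 - (A * A + + 4) ≡ - A * (A - 0ℤ)
    identity = solve-∀

  D≉0 : D ≉ 0ℤ
  D≉0 e = nonresidue 0ℤ (≈-sym e)

  -- If `d s` vanished, A² + 4 would equal s² + 2 + s*², a square. Its root is written (1 + s²) s*
  -- rather than s + s*, because the product of s and s* is known only up to sign.
  d≉0 : ∀ s → d s ≉ 0ℤ
  d≉0 s e = nonresidue ((1ℤ + sq s) * val (star s))
    (lincomb₂ (sq s + + 2) (- 1ℤ) (sq-star s) e (identity A (sq s) (val (star s))))
    where
    identity : ∀ A s t → (1ℤ + s) * t * ((1ℤ + s) * t) - (A * A + + 4) ≡
      (s + + 2) * (s * (t * t) - 1ℤ) + - 1ℤ * (A * A + + 2 - s - t * t - 0ℤ)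
    identity = solve-∀

-- Evaluation of T by conjugate roots α and β outside the prime field.

module Conjugates (p : ℕ) (prime : Prime p) (h : ℕ) (p≡ : p ≡ suc (h ℕ.+ h)) (A : ℤ)
  (nonresidue : ∀ x → Congruence._≉_ p (x ℤ.* x) (A ℤ.* A ℤ.+ + 4))
  (R : CommutativeRing 0ℓ 0ℓ)
  (embedding : ℤ.+-*-rawRing -Raw-AlmostCommutative⟶ fromCommutativeRing R)
  (ι-cong : ∀ {a b : ℤ} → Congruence._≈_ p a b → CommutativeRing._≈_ R (⟦ embedding ⟧ a) (⟦ embedding ⟧ b))
  (ι-injective : ∀ {a b : ℤ} → CommutativeRing._≈_ R (⟦ embedding ⟧ a) (⟦ embedding ⟧ b) → Congruence._≈_ p a b)
  (ι-regular : ∀ {a : ℤ} → Congruence._≉_ p a 0ℤ → IntegerAlgebra.Regular R embedding (⟦ embedding ⟧ a))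
  (α β : CommutativeRing.Carrier R)
  (sum-αβ : CommutativeRing._≈_ R (CommutativeRing._+_ R α β) (⟦ embedding ⟧ A))
  (prod-αβ : CommutativeRing._≈_ R (CommutativeRing._*_ R α β) (⟦ embedding ⟧ (ℤ.- 1ℤ))) where
  open Characteristic p prime h p≡ R embedding ι-cong ι-regular
  private
    module P = Parts p prime h p≡ A
    module N = Nonresidue p prime h p≡ A nonresidue
  open P using (D; sq; val; star; part)
  open import Relation.Binary.Reasoning.Setoid setoid

  δ x γ : Carrier
  δ = α - β
  x = α ^ h
  γ = α * x

  δ²≈D : δ * δ ≈ ι D
  δ²≈D = begin
    δ * δ ≈⟨ combine₁ (ι (ℤ.- (+ 4))) prod-αβ (solve 2 (λ α β → (α :- β) :* (α :- β) :- ((α :+ β) :* (α :+ β) :+ con (+ 4)) :=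
               con (ℤ.- (+ 4)) :* (α :* β :- con (ℤ.- 1ℤ))) refl α β) ⟩
    (α + β) * (α + β) + ι (+ 4) ≈⟨ +-congʳ (*-cong sum-αβ sum-αβ) ⟩
    ι A * ι A + ι (+ 4) ≈⟨ +-congʳ (*-homo A A) ⟨
    ι (A ℤ.* A) + ι (+ 4) ≈⟨ +-homo (A ℤ.* A) (+ 4) ⟨
    ι D ∎

  -- The half of Euler's criterion for nonresidues: D^h = 1 would make the product of all D - s²
  -- vanish, whereas none of its factors does.
  euler : D ℤ.^ h P.≈ ℤ.- 1ℤ
  euler = [ ⊥-elim ∘ ≉1 , id ]′ (P.square-cases {D ℤ.^ h} {1ℤ}
    (P.≈-trans (P.≈-reflexive (≡.sym (^-distribʳ-* D D h))) (P.fermat N.D≉0)))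
    where
    S : Fin h → ℤ
    S s = D ℤ.- sq s
    product : ι (P.∏ S) ≈ ι (D ℤ.^ h) - 1#
    product = begin
      ι (P.∏ S) ≈⟨ ι-∏ S ⟩
      ∏ (ι ∘ S) ≈⟨ sum-cong-≋ (λ s → ι-minus D (sq s)) ⟩
      ∏ (λ s → ι D - ι (sq s)) ≈⟨ ∏-squares (ι D) ⟨
      ι D ^ h - 1# ≈⟨ +-congʳ (ι-^ D h) ⟨
      ι (D ℤ.^ h) - 1# ∎
    nonzero : ∀ s → S s P.≉ 0ℤ
    nonzero s e = nonresidue (val s) (P.lincomb₁ (ℤ.- 1ℤ) e (identity D (sq s)))
      where
      identity : ∀ d s → s ℤ.- d ≡ ℤ.- 1ℤ ℤ.* (d ℤ.- s ℤ.- 0ℤ)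
      identity = solve-∀
    ≉1 : D ℤ.^ h P.≉ 1ℤ
    ≉1 e = P.∏-≉0 S nonzero (ι-injective
      (trans product (trans (difference (trans (ι-cong e) 1-homo)) (sym 0-homo))))

  δ^p≈-δ : δ ^ p ≈ - δ
  δ^p≈-δ = begin
    δ ^ p ≈⟨ ^-congʳ δ p≡ ⟩
    δ * δ ^ (h ℕ.+ h) ≈⟨ *-congˡ (trans (^-homo-* δ h h) (sym (^-distrib-* δ δ h))) ⟩
    δ * (δ * δ) ^ h ≈⟨ *-congˡ (trans (^-congˡ h δ²≈D) (trans (sym (ι-^ D h)) (ι-cong euler))) ⟩
    δ * ι (ℤ.- 1ℤ) ≈⟨ solve 1 (λ d → d :* con (ℤ.- 1ℤ) := :- d) refl δ ⟩
    - δ ∎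

  private
    instance
      p≢0 : ℕ.NonZero p
      p≢0 = ≡.subst ℕ.NonZero (≡.sym p≡) _

  -- Frobenius is applied to 2α = δ + A, with A replaced by its least residue: 2 and A are fixed, δ
  -- changes sign, and -δ + A = 2β.
  α^p≈β : α ^ p ≈ β
  α^p≈β = equal (ι-regular P.2≉0 (α ^ p - β) (begin
    ι (+ 2) * (α ^ p - β) ≈⟨ solve 3 (λ t a b → t :* (a :- b) := t :* a :- t :* b) refl (ι (+ 2)) (α ^ p) β ⟩
    ι (+ 2) * α ^ p - ι (+ 2) * β ≈⟨ difference doubled ⟩
    0# ∎))
    where
    r : ℕ
    r = A %ℕ p
    A≈r : ι A ≈ ι (+ r)
    A≈r = ι-cong (P.by (A ℤ./ℕ p) (≡.trans (≡.cong (ℤ._- + r) (a≡a%ℕn+[a/ℕn]*n A p)) (identity (+ r) (A ℤ./ℕ p ℤ.* + p))))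
      where
      identity : ∀ r q → r ℤ.+ q ℤ.- r ≡ q
      identity = solve-∀
    2^p : ι (+ 2) ^ p ≈ ι (+ 2)
    2^p = begin
      ι (+ 2) ^ p ≈⟨ ι-^ (+ 2) p ⟨
      ι ((+ 2) ℤ.^ p) ≈⟨ ι-cong (P.≈-trans (P.≈-reflexive (≡.cong ((+ 2) ℤ.^_) p≡))
        (P.≈-trans (P.*-cong (P.≈-refl {+ 2}) (P.≈-trans (P.≈-reflexive (^-double (+ 2) h)) (P.fermat P.2≉0))) (P.≈-reflexive ≡.refl))) ⟩
      ι (+ 2) ∎
    doubled : ι (+ 2) * α ^ p ≈ ι (+ 2) * β
    doubled = begin
      ι (+ 2) * α ^ p ≈⟨ *-congʳ 2^p ⟨
      ι (+ 2) ^ p * α ^ p ≈⟨ ^-distrib-* (ι (+ 2)) α p ⟨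
      (ι (+ 2) * α) ^ p ≈⟨ ^-congˡ p (trans (solve 2 (λ α β → con (+ 2) :* α := (α :- β) :+ (α :+ β)) refl α β) (+-congˡ (trans sum-αβ A≈r))) ⟩
      (δ + ι (+ r)) ^ p ≈⟨ frobenius-shift r δ ⟩
      δ ^ p + ι (+ r) ≈⟨ +-cong δ^p≈-δ (sym (trans sum-αβ A≈r)) ⟩
      - δ + (α + β) ≈⟨ solve 2 (λ α β → :- (α :- β) :+ (α :+ β) := con (+ 2) :* β) refl α β ⟩
      ι (+ 2) * β ∎

  γ²≈-1 : γ * γ ≈ ι (ℤ.- 1ℤ)
  γ²≈-1 = begin
    (α * x) * (α * x) ≈⟨ solve 2 (λ α x → (α :* x) :* (α :* x) := α :* (α :* (x :* x))) refl α x ⟩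
    α * (α * (x * x)) ≈⟨ *-congˡ (*-congˡ (^-homo-* α h h)) ⟨
    α * α ^ suc (h ℕ.+ h) ≈⟨ *-congˡ (trans (sym (^-congʳ α p≡)) α^p≈β) ⟩
    α * β ≈⟨ prod-αβ ⟩
    ι (ℤ.- 1ℤ) ∎

  L : Fin h → Carrier
  L s = α + ι (sq s) * β

  d≈LL : ∀ s → ι (P.d s) ≈ L s * L (star s)
  d≈LL s = begin
    ι (A ℤ.* A ℤ.+ + 2 ℤ.- sq s ℤ.- sq (star s))
      ≈⟨ trans (ι-minus (A ℤ.* A ℤ.+ + 2 ℤ.- sq s) (sq (star s))) (+-congʳ (trans (ι-minus (A ℤ.* A ℤ.+ + 2) (sq s)) (+-congʳ (+-homo (A ℤ.* A) (+ 2))))) ⟩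
    ι (A ℤ.* A) + ι (+ 2) - ι (sq s) - ι (sq (star s))
      ≈⟨ +-congʳ (+-congʳ (+-congʳ (trans (*-homo A A) (sym (*-cong sum-αβ sum-αβ))))) ⟩
    (α + β) * (α + β) + ι (+ 2) - ι (sq s) - ι (sq (star s))
      ≈⟨ combine₂ (ι (+ 2) - (ι (sq s) + ι (sq (star s)))) (- (β * β)) prod-αβ (trans (sym (*-homo (sq s) (sq (star s)))) (ι-cong (P.sq-star s)))
           (solve 4 (λ α β s t → ((α :+ β) :* (α :+ β) :+ con (+ 2) :- s :- t) :- (α :+ s :* β) :* (α :+ t :* β) :=
             (con (+ 2) :- (s :+ t)) :* (α :* β :- con (ℤ.- 1ℤ)) :+ (:- (β :* β)) :* (s :* t :- con 1ℤ)) refl α β (ι (sq s)) (ι (sq (star s)))) ⟩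
    L s * L (star s) ∎

  -- From α + s²β = -β(α² - s²) the product is (-β)^h (α^(2h) - 1), that is x - b, where b = (-β)^h
  -- is the inverse of x. Since γ² = -1, -b equals α²x, and x + α²x = αx(α - β).
  ∏L≈γδ : ∏ L ≈ γ * δ
  ∏L≈γδ = begin
    ∏ L ≈⟨ sum-cong-≋ (λ s → combine₁ α prod-αβ (solve 3 (λ α β s → (α :+ s :* β) :- (:- β) :* (α :* α :- s) :=
               α :* (α :* β :- con (ℤ.- 1ℤ))) refl α β (ι (sq s)))) ⟩
    ∏ (λ s → (- β) * (α * α - ι (sq s))) ≈⟨ sum-scale (- β) (λ s → α * α - ι (sq s)) ⟩
    b * ∏ (λ s → α * α - ι (sq s)) ≈⟨ *-congˡ (∏-squares (α * α)) ⟨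
    b * ((α * α) ^ h - 1#) ≈⟨ *-congˡ (+-congʳ (^-distrib-* α α h)) ⟩
    b * (x * x - 1#) ≈⟨ solve 3 (λ b x o → b :* (x :* x :- o) := (b :* x) :* x :- b :* o) refl b x 1# ⟩
    (b * x) * x - b * 1# ≈⟨ +-cong (trans (*-congʳ bx≈1) (*-identityˡ x)) (-‿cong (*-identityʳ b)) ⟩
    x - b ≈⟨ combine₂ (ι (ℤ.- 1ℤ)) x α²x≈-b prod-αβ (solve 4 (λ α β x b → (x :- b) :- (α :* x) :* (α :- β) :=
               con (ℤ.- 1ℤ) :* ((α :* α) :* x :- (:- b)) :+ x :* (α :* β :- con (ℤ.- 1ℤ))) refl α β x b) ⟩
    γ * δ ∎
    where
    b : Carrier
    b = (- β) ^ h
    bx≈1 : b * x ≈ 1#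
    bx≈1 = begin
      b * x ≈⟨ ^-distrib-* (- β) α h ⟨
      (- β * α) ^ h ≈⟨ ^-congˡ h (trans (combine₁ (ι (ℤ.- 1ℤ)) prod-αβ (solve 2 (λ α β → (:- β) :* α :- con 1ℤ :=
                         con (ℤ.- 1ℤ) :* (α :* β :- con (ℤ.- 1ℤ))) refl α β)) 1-homo) ⟩
      1# ^ h ≈⟨ 1^ h ⟩
      1# ∎
    α²x≈-b : (α * α) * x ≈ - b
    α²x≈-b = begin
      (α * α) * x ≈⟨ *-identityˡ ((α * α) * x) ⟨
      1# * ((α * α) * x) ≈⟨ *-congʳ bx≈1 ⟨
      (b * x) * ((α * α) * x) ≈⟨ solve 3 (λ b x α → (b :* x) :* ((α :* α) :* x) := b :* ((α :* x) :* (α :* x))) refl b x α ⟩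
      b * (γ * γ) ≈⟨ *-congˡ γ²≈-1 ⟩
      b * ι (ℤ.- 1ℤ) ≈⟨ solve 1 (λ b → b :* con (ℤ.- 1ℤ) := :- b) refl b ⟩
      - b ∎

  private
    module StarProducts = Involution.Products star P.star-involutive *-commutativeMonoid

    open import Algebra.Properties.Ring (CommutativeRing.ring R) using (-1*x≈-x)

    pairs : ∀ s → s ≢ star s → ι (part s) * ι (part (star s)) ≈ - 1# * L s ^ h * (- 1# * L (star s) ^ h)
    pairs s _ = begin
      ι (part s) * ι (part (star s)) ≈⟨ *-homo (part s) (part (star s)) ⟨
      ι (part s ℤ.* part (star s)) ≈⟨ ι-cong (P.part-generic s (N.d≉0 s)) ⟩
      ι (P.d s ℤ.^ h) ≈⟨ ι-^ (P.d s) h ⟩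
      ι (P.d s) ^ h ≈⟨ ^-congˡ h (d≈LL s) ⟩
      (L s * L (star s)) ^ h ≈⟨ ^-distrib-* (L s) (L (star s)) h ⟩
      L s ^ h * L (star s) ^ h ≈⟨ solve 2 (λ y z → y :* z := (:- y) :* (:- z)) refl (L s ^ h) (L (star s) ^ h) ⟩
      - (L s ^ h) * - (L (star s) ^ h) ≈⟨ *-cong (-1*x≈-x (L s ^ h)) (-1*x≈-x (L (star s) ^ h)) ⟨
      - 1# * L s ^ h * (- 1# * L (star s) ^ h) ∎

    part-at-one : ι (part P.one) ≈ - (L P.one ^ h)
    part-at-one = begin
      ι (part P.one) ≈⟨ ι-cong (P.part-one N.A≉0) ⟩
      ι (ℤ.- (A ℤ.^ h)) ≈⟨ trans (-‿homo (A ℤ.^ h)) (-‿cong (ι-^ A h)) ⟩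
      - (ι A ^ h) ≈⟨ -‿cong (^-congˡ h (trans (sym sum-αβ) (+-congˡ
          (trans (solve 1 (λ β → β := con 1ℤ :* β) refl β) (*-congʳ (reflexive (≡.cong ι (≡.sym P.sq-one)))))))) ⟩
      - (L P.one ^ h) ∎

    imaginary : ∀ s → sq s P.≈ ℤ.- 1ℤ → ι (part s) ≈ - (L s ^ h)
    imaginary s s²≈-1 = begin
      ι (part s) ≈⟨ ι-cong (part-imaginary N.D≉0) ⟩
      ι (ℤ.- (D ℤ.^ quarter)) ≈⟨ trans (-‿homo (D ℤ.^ quarter)) (-‿cong (ι-^ D quarter)) ⟩
      - (ι D ^ quarter) ≈⟨ -‿cong (^-congˡ quarter δ²≈D) ⟨
      - ((δ * δ) ^ quarter) ≈⟨ -‿cong (trans (^-distrib-* δ δ quarter) (sym (^-homo-* δ quarter quarter))) ⟩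
      - (δ ^ (quarter ℕ.+ quarter)) ≈⟨ -‿cong (^-congʳ δ quarter+quarter≡h) ⟩
      - (δ ^ h) ≈⟨ -‿cong (^-congˡ h (trans (solve 2 (λ α β → α :- β := α :+ con (ℤ.- 1ℤ) :* β) refl α β)
                     (+-congˡ (*-congʳ (ι-cong (P.≈-sym s²≈-1)))))) ⟩
      - (L s ^ h) ∎
      where open P.Imaginary s s²≈-1

    fixes : ∀ s → s ≡ star s → ι (part s) ≈ - 1# * L s ^ h
    fixes s e = trans ([ (λ s²≈1 → ≡.subst (λ t → ι (part t) ≈ - (L t ^ h)) (≡.sym (P.sq≈1⇒one s²≈1)) part-at-one) ,
                         imaginary s ]′ (P.fixed-square e)) (sym (-1*x≈-x (L s ^ h)))

  ιT : ι (T p A) ≈ (- 1#) ^ h * (γ * δ) ^ h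
  ιT = begin
    ι (T p A) ≈⟨ ι-cong P.T≈∏part ⟩
    ι (P.∏ part) ≈⟨ ι-∏ part ⟩
    ∏ (ι ∘ part) ≈⟨ StarProducts.sum-pairs-cong (ι ∘ part) (λ s → - 1# * L s ^ h) pairs fixes ⟩
    ∏ (λ s → - 1# * L s ^ h) ≈⟨ sum-scale (- 1#) (λ s → L s ^ h) ⟩
    (- 1#) ^ h * ∏ (λ s → L s ^ h) ≈⟨ *-congˡ (trans (sum-· h L) (^-congˡ h ∏L≈γδ)) ⟩
    (- 1#) ^ h * (γ * δ) ^ h ∎

  E : ℤ
  E = ℤ.- (A ℤ.* A) ℤ.- + 4

  [γδ]²≈E : (γ * δ) * (γ * δ) ≈ ι E
  [γδ]²≈E = begin
    (γ * δ) * (γ * δ) ≈⟨ solve 2 (λ g d → (g :* d) :* (g :* d) := (g :* g) :* (d :* d)) refl γ δ ⟩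
    (γ * γ) * (δ * δ) ≈⟨ *-cong γ²≈-1 δ²≈D ⟩
    ι (ℤ.- 1ℤ) * ι D ≈⟨ *-homo (ℤ.- 1ℤ) D ⟨
    ι (ℤ.- 1ℤ ℤ.* D) ≈⟨ reflexive (≡.cong ι (identity A)) ⟩
    ι E ∎
    where
    identity : ∀ A → ℤ.- 1ℤ ℤ.* (A ℤ.* A ℤ.+ + 4) ≡ ℤ.- (A ℤ.* A) ℤ.- + 4
    identity = solve-∀

  private
    even-power : ∀ m y → y ^ (m ℕ.+ m) ≈ (y * y) ^ m
    even-power m y = trans (^-homo-* y m m) (sym (^-distrib-* y y m))

    even-sign : ∀ m → (- 1#) ^ (m ℕ.+ m) ≈ 1#
    even-sign m = trans (even-power m (- 1#)) (trans (^-congˡ m (trans (-1*x≈-x (- 1#)) (⁻¹-involutive 1#))) (1^ m))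
      where open import Algebra.Properties.Group +-group using (⁻¹-involutive)

    [γδ]^2m : ∀ m → (γ * δ) ^ (m ℕ.+ m) ≈ ι E ^ m
    [γδ]^2m m = trans (even-power m (γ * δ)) (^-congˡ m [γδ]²≈E)

  T-even : ∀ m → h ≡ m ℕ.+ m → T p A P.≈ E ℤ.^ m
  T-even m h≡ = ι-injective (begin
    ι (T p A) ≈⟨ ιT ⟩
    (- 1#) ^ h * (γ * δ) ^ h ≈⟨ *-cong (trans (^-congʳ (- 1#) h≡) (even-sign m)) (trans (^-congʳ (γ * δ) h≡) ([γδ]^2m m)) ⟩
    1# * ι E ^ m ≈⟨ *-identityˡ (ι E ^ m) ⟩
    ι E ^ m ≈⟨ ι-^ E m ⟨
    ι (E ℤ.^ m) ∎)

  -- As h + 1 is even, β^(h+1) is the inverse of γ, hence -γ, and Binet's formula gives u_(h+1) δ =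
  -- 2γ. The leftover -γδ is therefore -δ² u_(h+1) / 2, and -δ² raises the power of `E` by one.
  T-odd : ∀ m → h ≡ suc (m ℕ.+ m) → T p A P.≈ E ℤ.^ suc m ℤ.* u (suc h) A ℤ.* inv2 p
  T-odd m h≡ = ι-injective (begin
    ι (T p A) ≈⟨ ιT ⟩
    (- 1#) ^ h * (γ * δ) ^ h
      ≈⟨ *-cong (trans (^-congʳ (- 1#) h≡) (trans (*-congˡ (even-sign m)) (*-identityʳ (- 1#))))
                (trans (^-congʳ (γ * δ) h≡) (*-congˡ ([γδ]^2m m))) ⟩
    - 1# * ((γ * δ) * e) ≈⟨ -1*x≈-x ((γ * δ) * e) ⟩
    - ((γ * δ) * e) ≈⟨ combine₂ (e * (γ * δ)) (e * δ * i) 2i≈1 uδ≈2γ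
        (solve 5 (λ g d e i v → (:- ((g :* d) :* e)) :- (con (ℤ.- 1ℤ) :* (d :* d) :* e :* v :* i) :=
           (e :* (g :* d)) :* (con (+ 2) :* i :- con 1ℤ) :+ (e :* d :* i) :* (v :* d :- con (+ 2) :* g)) refl γ δ e i v) ⟩
    ι (ℤ.- 1ℤ) * (δ * δ) * e * v * i ≈⟨ *-congʳ (*-congʳ (*-cong (trans (*-congˡ δ²≈D)
        (trans (sym (*-homo (ℤ.- 1ℤ) D)) (reflexive (≡.cong ι (identity A))))) (sym (ι-^ E m)))) ⟩
    ι E * ι (E ℤ.^ m) * v * i ≈⟨ *-congʳ (*-congʳ (*-homo E (E ℤ.^ m))) ⟨
    ι (E ℤ.^ suc m) * v * i ≈⟨ *-congʳ (*-homo (E ℤ.^ suc m) (u (suc h) A)) ⟨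
    ι (E ℤ.^ suc m ℤ.* u (suc h) A) * i ≈⟨ *-homo (E ℤ.^ suc m ℤ.* u (suc h) A) (inv2 p) ⟨
    ι (E ℤ.^ suc m ℤ.* u (suc h) A ℤ.* inv2 p) ∎)
    where
    e i v β′ : Carrier
    e = ι E ^ m
    i = ι (inv2 p)
    v = ι (u (suc h) A)
    β′ = β ^ suc h
    identity : ∀ A → ℤ.- 1ℤ ℤ.* (A ℤ.* A ℤ.+ + 4) ≡ ℤ.- (A ℤ.* A) ℤ.- + 4
    identity = solve-∀
    2i≈1 : ι (+ 2) * i ≈ ι 1ℤ
    2i≈1 = trans (sym (*-homo (+ 2) (inv2 p))) (ι-cong P.2*inv2≈1)
    γβ′≈1 : γ * β′ ≈ ι 1ℤ
    γβ′≈1 = begin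
      γ * β′ ≈⟨ ^-distrib-* α β (suc h) ⟨
      (α * β) ^ suc h ≈⟨ ^-congˡ (suc h) prod-αβ ⟩
      ι (ℤ.- 1ℤ) ^ suc h ≈⟨ ι-^ (ℤ.- 1ℤ) (suc h) ⟨
      ι ((ℤ.- 1ℤ) ℤ.^ suc h) ≈⟨ reflexive (≡.cong ι (≡.trans (≡.cong (λ k → (ℤ.- 1ℤ) ℤ.^ suc k) h≡)
        (≡.trans (minus-minus ((ℤ.- 1ℤ) ℤ.^ (m ℕ.+ m))) (≡.trans (^-double (ℤ.- 1ℤ) m) (ℤₚ.^-zeroˡ m))))) ⟩
      ι 1ℤ ∎
      where
      minus-minus : ∀ y → ℤ.- 1ℤ ℤ.* (ℤ.- 1ℤ ℤ.* y) ≡ y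
      minus-minus = solve-∀
    uδ≈2γ : v * δ ≈ ι (+ 2) * γ
    uδ≈2γ = begin
      v * δ ≈⟨ binet A sum-αβ prod-αβ (suc h) ⟩
      γ - β′ ≈⟨ combine₂ γ (- β′) γβ′≈1 γ²≈-1 (solve 2 (λ g b → (g :- b) :- con (+ 2) :* g :=
          g :* (g :* b :- con 1ℤ) :+ (:- b) :* (g :* g :- con (ℤ.- 1ℤ)))  refl γ β′) ⟩
      ι (+ 2) * γ ∎

-- The quadratic extension of the prime field by α.

-- ℤ[α]/(α² − Aα − 1) modulo p; an element is re + im α.
module QuadraticExtension (p : ℕ) (A : ℤ) where
  open Congruence p using (≈-refl; ≈-sym; ≈-trans; ≈-reflexive; +-cong; *-cong; -‿cong) renaming (_≈_ to _≈ₚ_)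
  open import Data.Integer using (_+_; _*_; -_; _-_)

  record K : Set where
    constructor mk
    field re im : ℤ
  open K public

  infix 4 _≈ᴷ_
  record _≈ᴷ_ (x y : K) : Set where
    constructor _,_
    field
      re≈ : re x ≈ₚ re y
      im≈ : im x ≈ₚ im y
  open _≈ᴷ_ public

  _+ᴷ_ _*ᴷ_ : K → K → K
  mk a b +ᴷ mk c d = mk (a + c) (b + d)
  mk a b *ᴷ mk c d = mk (a * c + b * d) (a * d + b * c + A * (b * d))

  -ᴷ_ : K → K
  -ᴷ mk a b = mk (- a) (- b)

  embed : ℤ → K
  embed n = mk n 0ℤ

  private
    exactly : ∀ {x y} → re x ≡ re y → im x ≡ im y → x ≈ᴷ y
    exactly e f = ≈-reflexive e , ≈-reflexive f

    *-assoc-re : ∀ A a b c d e f → (a * c + b * d) * e + (a * d + b * c + A * (b * d)) * f ≡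
                 a * (c * e + d * f) + b * (c * f + d * e + A * (d * f))
    *-assoc-re = solve-∀

    *-assoc-im : ∀ A a b c d e f →
      (a * c + b * d) * f + (a * d + b * c + A * (b * d)) * e + A * ((a * d + b * c + A * (b * d)) * f) ≡
      a * (c * f + d * e + A * (d * f)) + b * (c * e + d * f) + A * (b * (c * f + d * e + A * (d * f)))
    *-assoc-im = solve-∀

    *-comm-re : ∀ a b c d → a * c + b * d ≡ c * a + d * b
    *-comm-re = solve-∀

    *-comm-im : ∀ A a b c d → a * d + b * c + A * (b * d) ≡ c * b + d * a + A * (d * b)
    *-comm-im = solve-∀

    identity-re : ∀ a b → 1ℤ * a + 0ℤ * b ≡ a
    identity-re = solve-∀

    identity-im : ∀ A a b → 1ℤ * b + 0ℤ * a + A * (0ℤ * b) ≡ b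
    identity-im = solve-∀

    distrib-re : ∀ a b c d e f → a * (c + e) + b * (d + f) ≡ (a * c + b * d) + (a * e + b * f)
    distrib-re = solve-∀

    distrib-im : ∀ A a b c d e f → a * (d + f) + b * (c + e) + A * (b * (d + f)) ≡
      (a * d + b * c + A * (b * d)) + (a * f + b * e + A * (b * f))
    distrib-im = solve-∀

    commutes : ∀ x y → (x *ᴷ y) ≈ᴷ (y *ᴷ x)
    commutes (mk a b) (mk c d) = exactly (*-comm-re a b c d) (*-comm-im A a b c d)

    transitive : ∀ {x y z} → x ≈ᴷ y → y ≈ᴷ z → x ≈ᴷ z
    transitive (e , f) (g , h) = ≈-trans e g , ≈-trans f h

    cong-* : ∀ {x y u v} → x ≈ᴷ y → u ≈ᴷ v → (x *ᴷ u) ≈ᴷ (y *ᴷ v)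
    cong-* (e , f) (g , h) = +-cong (*-cong e g) (*-cong f h) ,
      +-cong (+-cong (*-cong e h) (*-cong f g)) (*-cong (≈-refl {A}) (*-cong f h))

    cong-+ : ∀ {x y u v} → x ≈ᴷ y → u ≈ᴷ v → (x +ᴷ u) ≈ᴷ (y +ᴷ v)
    cong-+ (e , f) (g , h) = +-cong e g , +-cong f h

    equivalence : IsEquivalence _≈ᴷ_
    equivalence = record
      { refl = ≈-refl , ≈-refl
      ; sym = λ { (e , f) → ≈-sym e , ≈-sym f }
      ; trans = transitive }

    one-* : ∀ x → (mk 1ℤ 0ℤ *ᴷ x) ≈ᴷ x
    one-* (mk a b) = exactly (identity-re a b) (identity-im A a b)

    distributes : ∀ x y z → (x *ᴷ (y +ᴷ z)) ≈ᴷ ((x *ᴷ y) +ᴷ (x *ᴷ z))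
    distributes (mk a b) (mk c d) (mk e f) = exactly (distrib-re a b c d e f) (distrib-im A a b c d e f)

  ring : CommutativeRing 0ℓ 0ℓ
  ring = record
    { Carrier = K ; _≈_ = _≈ᴷ_ ; _+_ = _+ᴷ_ ; _*_ = _*ᴷ_ ; -_ = -ᴷ_ ; 0# = mk 0ℤ 0ℤ ; 1# = mk 1ℤ 0ℤ
    ; isCommutativeRing = record
      { isRing = record
        { +-isAbelianGroup = record
          { isGroup = record
            { isMonoid = record
              { isSemigroup = record
                { isMagma = record { isEquivalence = equivalence ; ∙-cong = cong-+ }
                ; assoc = λ { (mk a b) (mk c d) (mk e f) → exactly (ℤₚ.+-assoc a c e) (ℤₚ.+-assoc b d f) } }
              ; identity = (λ { (mk a b) → exactly (ℤₚ.+-identityˡ a) (ℤₚ.+-identityˡ b) }) ,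
                           (λ { (mk a b) → exactly (ℤₚ.+-identityʳ a) (ℤₚ.+-identityʳ b) }) }
            ; inverse = (λ { (mk a b) → exactly (ℤₚ.+-inverseˡ a) (ℤₚ.+-inverseˡ b) }) ,
                        (λ { (mk a b) → exactly (ℤₚ.+-inverseʳ a) (ℤₚ.+-inverseʳ b) })
            ; ⁻¹-cong = λ { (e , f) → -‿cong e , -‿cong f } }
          ; comm = λ { (mk a b) (mk c d) → exactly (ℤₚ.+-comm a c) (ℤₚ.+-comm b d) } }
        ; *-cong = cong-*
        ; *-assoc = λ { (mk a b) (mk c d) (mk e f) → exactly (*-assoc-re A a b c d e f) (*-assoc-im A a b c d e f) }
        ; *-identity = one-* , λ x → transitive (commutes x (mk 1ℤ 0ℤ)) (one-* x)
        ; distrib = distributes , λ x y z → transitive (commutes (y +ᴷ z) x)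
            (transitive (distributes x y z) (cong-+ (commutes x y) (commutes x z))) }
      ; *-comm = commutes } }

  embedding : ℤ.+-*-rawRing -Raw-AlmostCommutative⟶ fromCommutativeRing ring
  embedding = record
    { ⟦_⟧ = embed
    ; +-homo = λ a b → exactly ≡.refl ≡.refl
    ; *-homo = λ a b → exactly (product-re a b) (product-im A a b)
    ; -‿homo = λ a → exactly ≡.refl ≡.refl
    ; 0-homo = exactly ≡.refl ≡.refl
    ; 1-homo = exactly ≡.refl ≡.refl }
    where
    product-re : ∀ a b → a * b ≡ a * b + 0ℤ * 0ℤ
    product-re = solve-∀
    product-im : ∀ A a b → 0ℤ ≡ a * 0ℤ + 0ℤ * b + A * (0ℤ * 0ℤ)
    product-im = solve-∀

module QuadraticCharacteristic (p : ℕ) (prime : Prime p) (A : ℤ) where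
  open Primality p prime
  open QuadraticExtension p A hiding (ring)
  open import Data.Integer using (_+_; _*_; _-_)

  embed-cong : ∀ {a b} → a ≈ b → embed a ≈ᴷ embed b
  embed-cong e = e , ≈-refl

  embed-regular : ∀ {a} → a ≉ 0ℤ → ∀ y → (embed a *ᴷ y) ≈ᴷ mk 0ℤ 0ℤ → y ≈ᴷ mk 0ℤ 0ℤ
  embed-regular {a} a≉0 (mk c d) (e , f) = c≈0 , d≈0
    where
    identity-re : ∀ a c d → a * c - a * 0ℤ ≡ 1ℤ * (a * c + 0ℤ * d - 0ℤ)
    identity-re = solve-∀
    identity-im : ∀ A a c d → a * d - a * 0ℤ ≡ 1ℤ * (a * d + 0ℤ * c + A * (0ℤ * d) - 0ℤ)
    identity-im = solve-∀
    e′ : a * c + 0ℤ * d ≈ 0ℤ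
    e′ = e
    f′ : a * d + 0ℤ * c + A * (0ℤ * d) ≈ 0ℤ
    f′ = f
    c≈0 : c ≈ 0ℤ
    c≈0 = cancelˡ {a} a≉0 {c} {0ℤ} (lincomb₁ {a * c + 0ℤ * d} {0ℤ} {a * c} {a * 0ℤ} 1ℤ e′ (identity-re a c d))
    d≈0 : d ≈ 0ℤ
    d≈0 = cancelˡ {a} a≉0 {d} {0ℤ} (lincomb₁ {a * d + 0ℤ * c + A * (0ℤ * d)} {0ℤ} {a * d} {a * 0ℤ} 1ℤ f′ (identity-im A a c d))

module NonresidueCase (p : ℕ) (prime : Prime p) (h : ℕ) (p≡ : p ≡ suc (h ℕ.+ h)) (A : ℤ)
  (nonresidue : ∀ x → Congruence._≉_ p (x ℤ.* x) (A ℤ.* A ℤ.+ + 4)) where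
  open Congruence p hiding (ring)
  open QuadraticExtension p A
  open QuadraticCharacteristic p prime A
  open import Data.Integer using (_+_; _*_; -_; _^_)

  private
    α β : K
    α = mk 0ℤ 1ℤ
    β = mk A (- 1ℤ)

    sum-αβ : (α +ᴷ β) ≈ᴷ embed A
    sum-αβ = ≈-reflexive (ℤₚ.+-identityˡ A) , ≈-refl

    prod-αβ : (α *ᴷ β) ≈ᴷ embed (- 1ℤ)
    prod-αβ = ≈-reflexive (identity-re A) , ≈-reflexive (identity-im A)
      where
      identity-re : ∀ A → 0ℤ * A + 1ℤ * - 1ℤ ≡ - 1ℤ
      identity-re = solve-∀
      identity-im : ∀ A → 0ℤ * - 1ℤ + 1ℤ * A + A * (1ℤ * - 1ℤ) ≡ 0ℤ
      identity-im = solve-∀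

    embed-injective : ∀ {a b} → embed a ≈ᴷ embed b → a ≈ b
    embed-injective = re≈

  T-even : ∀ m → h ≡ m ℕ.+ m → T p A ≈ (- (A * A) ℤ.- + 4) ^ m
  T-even = Conjugates.T-even p prime h p≡ A nonresidue ring embedding
    (λ {a} {b} → embed-cong {a} {b}) (λ {a} {b} → embed-injective {a} {b}) (λ {a} → embed-regular {a}) α β sum-αβ prod-αβ

  T-odd : ∀ m → h ≡ suc (m ℕ.+ m) → T p A ≈ (- (A * A) ℤ.- + 4) ^ suc m * u (suc h) A * inv2 p
  T-odd = Conjugates.T-odd p prime h p≡ A nonresidue ring embedding
    (λ {a} {b} → embed-cong {a} {b}) (λ {a} {b} → embed-injective {a} {b}) (λ {a} → embed-regular {a}) α β sum-αβ prod-αβ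

-- The Legendre symbol as a statement about square roots.

any-true : ∀ (P : ℕ → Bool) xs → any P xs ≡ true → ∃ λ x → P x ≡ true
any-true P (x ∷ xs) e with P x in eq
... | true = x , eq
... | false = any-true P xs e

any-false : ∀ (P : ℕ → Bool) {x} xs → any P xs ≡ false → x ∈ xs → P x ≡ false
any-false P (y ∷ xs) e x∈ with P y in eq
any-false P (y ∷ xs) () x∈ | true
any-false P (y ∷ xs) e (here ≡.refl) | false = eq
any-false P (y ∷ xs) e (there x∈) | false = any-false P xs e x∈

∈-range0 : ∀ {k n} → k ℕ.< n → k ∈ range0 n
∈-range0 {k} {suc n} (s≤s k≤n) with ℕₚ.m≤n⇒m<n∨m≡n k≤n
... | inj₁ k<n = ∈-++⁺ˡ (∈-range0 k<n)
... | inj₂ ≡.refl = ∈-++⁺ʳ (range0 n) (here ≡.refl)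

module Legendre (p : ℕ) (prime : Prime p) where
  open import Data.Integer using (_+_; _*_; -_; _-_)
  open Primality p prime

  divides?-true : ∀ {a} → divides? p a ≡ true → a ≈ 0ℤ
  divides?-true {a} e with p ℕᵈ.∣? ∣ a ∣
  ... | yes d = ∣⇒≈0 d

  divides?-false : ∀ {a} → divides? p a ≡ false → a ≉ 0ℤ
  divides?-false {a} e z with p ℕᵈ.∣? ∣ a ∣
  ... | no nd = nd (≈0⇒∣ z)

  private
    IsRoot : ℤ → ℕ → Bool
    IsRoot a x = divides? p ((+ x) * (+ x) - a)

    difference : ∀ {a b} → a - b ≈ 0ℤ → a ≈ b
    difference {a} {b} e = lincomb₁ 1ℤ e (identity a b)
      where
      identity : ∀ a b → a - b ≡ 1ℤ * (a - b - 0ℤ)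
      identity = solve-∀

  residue : ∀ {a} → legendre a p ≡ 1ℤ → a ≉ 0ℤ × ∃ λ x → x * x ≈ a
  residue {a} e with divides? p a in d | any (IsRoot a) (range0 p) in r
  residue () | true | _
  residue {a} e | false | true with any-true (IsRoot a) (range0 p) r
  ... | x , root = divides?-false d , + x , difference (divides?-true root)
  residue () | false | false

  nonresidue : ∀ {a} → legendre a p ≡ - 1ℤ → ∀ x → x * x ≉ a
  nonresidue {a} e x x²≈a with divides? p a in d | any (IsRoot a) (range0 p) in r
  nonresidue () x x²≈a | true | _
  nonresidue () x x²≈a | false | true
  nonresidue {a} e x x²≈a | false | false =
    divides?-false {(+ k) * (+ k) - a} (any-false (IsRoot a) (range0 p) r (∈-range0 {k} {p} k<p)) (lincomb₂ (+ k + x) 1ℤ k≈x x²≈a (identity a (+ k) x))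
    where
    instance
      p≢0 : ℕ.NonZero p
      p≢0 = prime⇒nonZero prime
    k : ℕ
    k = x %ℕ p
    k<p : k ℕ.< p
    k<p = n%ℕd<d x p
    k≈x : + k ≈ x
    k≈x = ≈-sym (by (x /ℕ p) (≡.trans (≡.cong (_- + k) (a≡a%ℕn+[a/ℕn]*n x p)) (identity′ (+ k) (x /ℕ p * + p))))
      where
      identity′ : ∀ r q → r + q - r ≡ q
      identity′ = solve-∀
    identity : ∀ a k x → k * k - a - 0ℤ ≡ (k + x) * (k - x) + 1ℤ * (x * x - a)
    identity = solve-∀

-- The residue and double-root congruences according to the parity of h and h/2.

module Cases (p : ℕ) (prime : Prime p) (h : ℕ) (p≡ : p ≡ suc (h ℕ.+ h)) (A : ℤ) where
  open import Data.Integer using (_+_; _*_; -_; _-_; _^_)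
  open Parts p prime h p≡ A using (D; 2*inv2≈1; fermat; fact; wilson; _≈_; _≉_; ≈-refl; ≈-sym; ≈-trans; ≈-reflexive; *-cong; ^-cong; -‿cong;
    lincomb₁; lincomb₂; lincomb₃; square-cases; halfFact≈fact; setoid)
  open import Relation.Binary.Reasoning.Setoid setoid

  -- The quadratic formula for z² = Az + 1, whose discriminant is `D`.
  root-of : ∀ x → x * x ≈ D → let α = (A + x) * inv2 p in α * α ≈ A * α + 1ℤ
  root-of x x²≈D = lincomb₂ (i * i) (+ 2 * i + 1ℤ + A * (A + x) * i) x²≈D 2*inv2≈1 (identity A x i)
    where
    i = inv2 p
    identity : ∀ A x i → (A + x) * i * ((A + x) * i) - (A * ((A + x) * i) + 1ℤ) ≡
      i * i * (x * x - (A * A + + 4)) + (+ 2 * i + 1ℤ + A * (A + x) * i) * (+ 2 * i - 1ℤ)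
    identity = solve-∀

  module Residue (x : ℤ) (x²≈D : x * x ≈ D) (D≉0 : D ≉ 0ℤ) where
    α y : ℤ
    α = (A + x) * inv2 p
    y = α ^ h
    open Split p prime h p≡ A α (root-of x x²≈D) using (T-split; δ; β; δ²≈D; αβ≈-1; α≉0)

    private
      y²≈1 : y * y ≈ 1ℤ
      y²≈1 = ≈-trans (≈-reflexive (≡.sym (^-distribʳ-* α α h))) (fermat α≉0)

      y^2m : ∀ m → y ^ (m ℕ.+ m) ≈ 1ℤ
      y^2m m = ≈-trans (≈-reflexive (^-double y m)) (≈-trans (^-cong m y²≈1) (≈-reflexive (ℤₚ.^-zeroˡ m)))

      δ^2m : ∀ m → δ ^ (m ℕ.+ m) ≈ D ^ m
      δ^2m m = ≈-trans (≈-reflexive (^-double δ m)) (^-cong m δ²≈D)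

      binet : ∀ n → (u n A * δ ≈ α ^ n - β ^ n) × (u (suc n) A * δ ≈ α ^ suc n - β ^ suc n)
      binet zero = ≈-refl , ≈-reflexive (identity α β)
        where
        identity : ∀ a b → 1ℤ * (a - b) ≡ a * 1ℤ - b * 1ℤ
        identity = solve-∀
      binet (suc n) with binet n
      ... | e , f = f , lincomb₃ 1ℤ A (α ^ n - β ^ n) e f αβ≈-1 (identity A α (u n A) (u (suc n) A) (α ^ n) (β ^ n))
        where
        identity : ∀ A α v w a b → (A * w + v) * (α - (A - α)) - (α * (α * a) - (A - α) * ((A - α) * b)) ≡
          1ℤ * (v * (α - (A - α)) - (a - b)) + A * (w * (α - (A - α)) - (α * a - (A - α) * b)) + (a - b) * (α * (A - α) - - 1ℤ)
        identity = solve-∀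

    T-even : ∀ m → h ≡ m ℕ.+ m → T p A ≈ - (D ^ m)
    T-even m h≡ = begin
      T p A ≈⟨ T-split D≉0 ⟩
      - (δ ^ h * y ^ h) ≡⟨ ≡.cong (λ k → - (δ ^ k * y ^ k)) h≡ ⟩
      - (δ ^ (m ℕ.+ m) * y ^ (m ℕ.+ m)) ≈⟨ -‿cong (*-cong (δ^2m m) (y^2m m)) ⟩
      - (D ^ m * 1ℤ) ≡⟨ ≡.cong -_ (ℤₚ.*-identityʳ (D ^ m)) ⟩
      - (D ^ m) ∎

    -- For odd h the power y^h is y, the quadratic character of α. From yβ^h = (-1)^h = -1 and y² =
    -- 1 follows β^h = -y, so u_h δ = 2y by Binet's formula, and δy = δ² u_h / 2.
    T-odd : ∀ m → h ≡ suc (m ℕ.+ m) → T p A ≈ - (D ^ suc m) * u h A * inv2 p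
    T-odd m h≡ = begin
      T p A ≈⟨ T-split D≉0 ⟩
      - (δ ^ h * y ^ h) ≡⟨ ≡.cong (λ k → - (δ ^ k * y ^ k)) h≡ ⟩
      - (δ * δ ^ (m ℕ.+ m) * (y * y ^ (m ℕ.+ m))) ≈⟨ -‿cong (*-cong (*-cong (≈-refl {δ}) (δ^2m m)) (*-cong (≈-refl {y}) (y^2m m))) ⟩
      - (δ * D ^ m * (y * 1ℤ)) ≈⟨ lincomb₂ (δ * D ^ m * y) (δ * D ^ m * i) 2*inv2≈1 uδ≈2y (identity₁ δ (D ^ m) y i (u h A)) ⟩
      - (δ * δ * D ^ m) * u h A * i ≈⟨ *-cong (*-cong (-‿cong (*-cong δ²≈D (≈-refl {D ^ m}))) (≈-refl {u h A})) (≈-refl {i}) ⟩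
      - (D * D ^ m) * u h A * i ∎
      where
      i z : ℤ
      i = inv2 p
      z = β ^ h
      identity₁ : ∀ δ e y i v → - (δ * e * (y * 1ℤ)) - - (δ * δ * e) * v * i ≡
        δ * e * y * (+ 2 * i - 1ℤ) + δ * e * i * (v * δ - + 2 * y)
      identity₁ = solve-∀
      yz≈-1 : y * z ≈ - 1ℤ
      yz≈-1 = begin
        y * z ≡⟨ ^-distribʳ-* α β h ⟨
        (α * β) ^ h ≈⟨ ^-cong h αβ≈-1 ⟩
        (- 1ℤ) ^ h ≡⟨ ≡.cong ((- 1ℤ) ^_) h≡ ⟩
        - 1ℤ * (- 1ℤ) ^ (m ℕ.+ m) ≡⟨ ≡.cong (- 1ℤ *_) (≡.trans (^-double (- 1ℤ) m) (ℤₚ.^-zeroˡ m)) ⟩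
        - 1ℤ ∎
      uδ≈2y : u h A * δ ≈ + 2 * y
      uδ≈2y = lincomb₃ 1ℤ (- y) z (proj₁ (binet h)) yz≈-1 y²≈1 (identity₂ (u h A * δ) y z)
        where
        identity₂ : ∀ w y z → w - + 2 * y ≡ 1ℤ * (w - (y - z)) + - y * (y * z - - 1ℤ) + z * (y * y - 1ℤ)
        identity₂ = solve-∀

  module DoubleRoot (D≈0 : D ≈ 0ℤ) where
    α : ℤ
    α = A * inv2 p
    α² : α * α ≈ A * α + 1ℤ
    α² = ≡.subst (λ t → t * inv2 p * (t * inv2 p) ≈ A * (t * inv2 p) + 1ℤ) (ℤₚ.+-identityʳ A) (root-of 0ℤ (≈-sym D≈0))
    open Split p prime h p≡ A α α² using (T-double-root; D≈0⇒α²≈-1)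

    α²≈-1 : α * α ≈ - 1ℤ
    α²≈-1 = D≈0⇒α²≈-1 D≈0

    m : ℕ
    m = proj₁ (T-double-root D≈0)

    m+m≡h : m ℕ.+ m ≡ h
    m+m≡h = proj₁ (proj₂ (T-double-root D≈0))

    T≈ : T p A ≈ - (α ^ m * fact)
    T≈ = proj₂ (proj₂ (T-double-root D≈0))

    fact²≈-1 : fact * fact ≈ - 1ℤ
    fact²≈-1 = ≈-trans (≈-reflexive (≡.sym (≡.trans (≡.cong (_* (fact * fact)) even) (ℤₚ.*-identityˡ (fact * fact))))) wilson
      where
      even : (- 1ℤ) ^ h ≡ 1ℤ
      even = ≡.trans (≡.cong ((- 1ℤ) ^_) (≡.sym m+m≡h)) (≡.trans (^-double (- 1ℤ) m) (ℤₚ.^-zeroˡ m))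

    -- Both A/2 and h! are square roots of -1, the latter by Wilson with h even; `k` records their
    -- relative sign.
    α≈±fact : ∃ λ k → k ≤ 1 × α ≈ (- 1ℤ) ^ k * fact
    α≈±fact = [ (λ e → 0 , z≤n , ≈-trans e (≈-reflexive (≡.sym (ℤₚ.*-identityˡ fact)))) ,
                (λ e → 1 , s≤s z≤n , ≈-trans e (≈-reflexive (≡.sym (ℤₚ.-1*i≡-i fact)))) ]′
              (square-cases {α} {fact} (≈-trans α²≈-1 (≈-sym fact²≈-1)))

    α^2n : ∀ n → α ^ (n ℕ.+ n) ≈ (- 1ℤ) ^ n
    α^2n n = ≈-trans (≈-reflexive (^-double α n)) (^-cong n α²≈-1)

    T-even : ∀ n → m ≡ n ℕ.+ n → T p A ≈ (- 1ℤ) ^ suc n * halfFact p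
    T-even n m≡ = begin
      T p A ≈⟨ T≈ ⟩
      - (α ^ m * fact) ≡⟨ ≡.cong (λ k → - (α ^ k * fact)) m≡ ⟩
      - (α ^ (n ℕ.+ n) * fact) ≈⟨ -‿cong (*-cong (α^2n n) (≈-sym halfFact≈fact)) ⟩
      - ((- 1ℤ) ^ n * halfFact p) ≡⟨ identity ((- 1ℤ) ^ n) (halfFact p) ⟩
      (- 1ℤ) ^ suc n * halfFact p ∎
      where
      identity : ∀ e f → - (e * f) ≡ - 1ℤ * e * f
      identity = solve-∀

    -- The odd exponent leaves one α next to the factorial. Their product is (-1)^k (h!)² = -(-1)^k,
    -- which removes both the factorial and the leading minus sign.
    T-odd : ∀ n k → m ≡ suc (n ℕ.+ n) → α ≈ (- 1ℤ) ^ k * fact → T p A ≈ (- 1ℤ) ^ (k ℕ.+ n)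
    T-odd n k m≡ α≈ = begin
      T p A ≈⟨ T≈ ⟩
      - (α ^ m * fact) ≡⟨ ≡.cong (λ k → - (α ^ k * fact)) m≡ ⟩
      - (α * α ^ (n ℕ.+ n) * fact) ≈⟨ -‿cong (*-cong (*-cong α≈ (α^2n n)) (≈-refl {fact})) ⟩
      - ((- 1ℤ) ^ k * fact * (- 1ℤ) ^ n * fact)
        ≈⟨ lincomb₁ (- ((- 1ℤ) ^ k * (- 1ℤ) ^ n)) fact²≈-1 (identity ((- 1ℤ) ^ k) ((- 1ℤ) ^ n) fact) ⟩
      (- 1ℤ) ^ k * (- 1ℤ) ^ n ≡⟨ ℤₚ.^-distribˡ-+-* (- 1ℤ) k n ⟨
      (- 1ℤ) ^ (k ℕ.+ n) ∎
      where
      identity : ∀ a b f → - (a * f * b * f) - a * b ≡ - (a * b) * (f * f - - 1ℤ)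
      identity = solve-∀

-- The exponents in terms of p modulo 4 and modulo 8.

halve : ∀ {a b} → a ℕ.+ a ≡ b ℕ.+ b → a ≡ b
halve {a} {b} e = ℕₚ.*-cancelˡ-≡ a b 2 (≡.trans (double a) (≡.trans e (≡.sym (double b))))
  where
  double : ∀ n → 2 ℕ.* n ≡ n ℕ.+ n
  double = ℕ-Solver.solve-∀

odd-prime : ∀ p → Prime p → p ≢ 2 → p ≡ suc (p / 2 ℕ.+ p / 2)
odd-prime p p-prime p≢2 with p % 2 | m≡m%n+[m/n]*n p 2 | m%n<n p 2
... | 0 | e | _ = ⊥-elim ([ (λ ()) , (λ 2≡p → p≢2 (≡.sym 2≡p)) ]′ (prime⇒irreducible p-prime (ℕᵈ.divides (p / 2) e)))
... | 1 | e | _ = ≡.trans e (identity (p / 2))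
  where
  identity : ∀ q → 1 ℕ.+ q ℕ.* 2 ≡ suc (q ℕ.+ q)
  identity = ℕ-Solver.solve-∀
... | suc (suc _) | _ | s≤s (s≤s ())

div-mod : ∀ p d .{{_ : ℕ.NonZero d}} {r} → p % d ≡ r → p ≡ r ℕ.+ (p / d) ℕ.* d
div-mod p d e = ≡.trans (m≡m%n+[m/n]*n p d) (≡.cong (ℕ._+ (p / d) ℕ.* d) e)

module Arithmetic (p h : ℕ) (p≡ : p ≡ suc (h ℕ.+ h)) where

  half-pred : (p ∸ 1) / 2 ≡ h
  half-pred = ≡.trans (≡.cong (λ n → (n ∸ 1) / 2) p≡) (≡.trans (≡.cong (_/ 2) (identity h)) (m*n/n≡m h 2))
    where
    identity : ∀ h → h ℕ.+ h ≡ h ℕ.* 2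
    identity = ℕ-Solver.solve-∀

  half-suc : (p ℕ.+ 1) / 2 ≡ suc h
  half-suc = ≡.trans (≡.cong (λ n → (n ℕ.+ 1) / 2) p≡) (≡.trans (≡.cong (_/ 2) (identity h)) (m*n/n≡m (suc h) 2))
    where
    identity : ∀ h → suc (h ℕ.+ h) ℕ.+ 1 ≡ suc h ℕ.* 2
    identity = ℕ-Solver.solve-∀

  module _ {r d} .{{_ : ℕ.NonZero d}} (p% : p % d ≡ r) where

    exact-∸ : (p ∸ r) / d ≡ p / d
    exact-∸ = ≡.trans (≡.cong (λ n → (n ∸ r) / d) (div-mod p d p%))
      (≡.trans (≡.cong (_/ d) (ℕₚ.m+n∸m≡n r ((p / d) ℕ.* d))) (m*n/n≡m (p / d) d))

    -- Serves (p + 7)/8 with remainder 1 and (p + 1)/4 with remainder 3. The successor matches the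
    -- leading minus sign in the former use and the extra factor δ² in the latter.
    exact-+ : ∀ s → s ℕ.+ r ≡ d → (p ℕ.+ s) / d ≡ suc (p / d)
    exact-+ s s+r≡d = ≡.trans (≡.cong (λ n → (n ℕ.+ s) / d) (div-mod p d p%))
      (≡.trans (≡.cong (_/ d) (≡.trans (ℕₚ.+-comm (r ℕ.+ (p / d) ℕ.* d) s)
        (≡.trans (≡.sym (ℕₚ.+-assoc s r ((p / d) ℕ.* d))) (≡.cong (ℕ._+ (p / d) ℕ.* d) s+r≡d))))
        (m*n/n≡m (suc (p / d)) d))

  h≡-mod1 : p % 4 ≡ 1 → h ≡ p / 4 ℕ.+ p / 4
  h≡-mod1 p% = halve (ℕₚ.suc-injective (≡.trans (≡.sym p≡) (≡.trans (div-mod p 4 p%) (identity (p / 4)))))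
    where
    identity : ∀ q → 1 ℕ.+ q ℕ.* 4 ≡ suc ((q ℕ.+ q) ℕ.+ (q ℕ.+ q))
    identity = ℕ-Solver.solve-∀

  h≡-mod3 : p % 4 ≡ 3 → h ≡ suc (p / 4 ℕ.+ p / 4)
  h≡-mod3 p% = halve (ℕₚ.suc-injective (≡.trans (≡.sym p≡) (≡.trans (div-mod p 4 p%) (identity (p / 4)))))
    where
    identity : ∀ q → 3 ℕ.+ q ℕ.* 4 ≡ suc (suc (q ℕ.+ q) ℕ.+ suc (q ℕ.+ q))
    identity = ℕ-Solver.solve-∀

  module _ (m : ℕ) (m+m≡h : m ℕ.+ m ≡ h) where

    p≡1+4m : p ≡ 1 ℕ.+ m ℕ.* 4
    p≡1+4m = ≡.trans p≡ (≡.trans (≡.cong (λ n → suc (n ℕ.+ n)) (≡.sym m+m≡h)) (identity m))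
      where
      identity : ∀ m → suc ((m ℕ.+ m) ℕ.+ (m ℕ.+ m)) ≡ 1 ℕ.+ m ℕ.* 4
      identity = ℕ-Solver.solve-∀

    p%4≡1 : p % 4 ≡ 1
    p%4≡1 = ≡.trans (≡.cong (_% 4) p≡1+4m) ([m+kn]%n≡m%n 1 m 4)

    m≡-mod1 : p % 8 ≡ 1 → m ≡ p / 8 ℕ.+ p / 8
    m≡-mod1 p% = ℕₚ.*-cancelʳ-≡ m (p / 8 ℕ.+ p / 8) 4
      (ℕₚ.suc-injective (≡.trans (≡.sym p≡1+4m) (≡.trans (div-mod p 8 p%) (identity (p / 8)))))
      where
      identity : ∀ q → 1 ℕ.+ q ℕ.* 8 ≡ suc ((q ℕ.+ q) ℕ.* 4)
      identity = ℕ-Solver.solve-∀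

    m≡-mod5 : p % 8 ≡ 5 → m ≡ suc (p / 8 ℕ.+ p / 8)
    m≡-mod5 p% = ℕₚ.*-cancelʳ-≡ m (suc (p / 8 ℕ.+ p / 8)) 4
      (ℕₚ.suc-injective (≡.trans (≡.sym p≡1+4m) (≡.trans (div-mod p 8 p%) (identity (p / 8)))))
      where
      identity : ∀ q → 5 ℕ.+ q ℕ.* 8 ≡ suc (suc (q ℕ.+ q) ℕ.* 4)
      identity = ℕ-Solver.solve-∀

-- The three cases for the quadratic character of A² + 4.

open import Data.Integer using (_*_; _+_; -_; _^_)

theorem1p4 : (p : ℕ) → Prime p → p ≢ 2 → (A : ℤ) →
    (((+ p) ℤD.∣ (A * A + + 4)) →
    (p % 4 ≡ 1) ×
    Σ ℕ (λ k → (k ≤ 1) ×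
    ((A * inv2 p) ≡ ((- 1ℤ) ^ k) * halfFact p [mod p ]) ×
    ((p % 8 ≡ 1) → T p A ≡ ((- 1ℤ) ^ ((p ℕ.+ 7) / 8)) * halfFact p [mod p ]) ×
    ((p % 8 ≡ 5) → T p A ≡ (- 1ℤ) ^ (k ℕ.+ (p ∸ 5) / 8) [mod p ])))
    ×
    ((legendre (A * A + + 4) p ≡ 1ℤ) →
    ((p % 4 ≡ 1) → T p A ≡ - ((A * A + + 4) ^ ((p ∸ 1) / 4)) [mod p ]) ×
    ((p % 4 ≡ 3) → T p A ≡ - ((A * A + + 4) ^ ((p ℕ.+ 1) / 4)) * u ((p ∸ 1) / 2) A * inv2 p [mod p ]))
    ×
    ((legendre (A * A + + 4) p ≡ - 1ℤ) →
    ((p % 4 ≡ 1) → T p A ≡ (- (A * A) ℤ.- + 4) ^ ((p ∸ 1) / 4) [mod p ]) ×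
    ((p % 4 ≡ 3) → T p A ≡ ((- (A * A) ℤ.- + 4) ^ ((p ℕ.+ 1) / 4)) * u ((p ℕ.+ 1) / 2) A * inv2 p [mod p ]))
theorem1p4 p p-prime p≢2 A = double-root , residue-case , nonresidue-case
  where
  h : ℕ
  h = p / 2
  p≡ : p ≡ suc (h ℕ.+ h)
  p≡ = odd-prime p p-prime p≢2
  open Arithmetic p h p≡
  open Congruence p using (≈⇒∣; ∣⇒≈0; ≈-trans; ≈-sym; ≈-refl; *-cong) renaming (_≈_ to _≈ₚ_)

  double-root : ((+ p) ℤD.∣ (A * A + + 4)) →
    (p % 4 ≡ 1) ×
    Σ ℕ (λ k → (k ≤ 1) ×
    ((A * inv2 p) ≡ ((- 1ℤ) ^ k) * halfFact p [mod p ]) ×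
    ((p % 8 ≡ 1) → T p A ≡ ((- 1ℤ) ^ ((p ℕ.+ 7) / 8)) * halfFact p [mod p ]) ×
    ((p % 8 ≡ 5) → T p A ≡ (- 1ℤ) ^ (k ℕ.+ (p ∸ 5) / 8) [mod p ]))
  double-root p∣D = p%4≡1 m m+m≡h , k , proj₁ (proj₂ root) , ≈⇒∣ α≈±halfFact , mod1 , mod5
    where
    D≈0 : A * A + + 4 ≈ₚ 0ℤ
    D≈0 = ∣⇒≈0 p∣D
    m : ℕ
    m = Cases.DoubleRoot.m p p-prime h p≡ A D≈0
    m+m≡h : m ℕ.+ m ≡ h
    m+m≡h = Cases.DoubleRoot.m+m≡h p p-prime h p≡ A D≈0
    root : ∃ λ k → k ≤ 1 × A * inv2 p ≈ₚ (- 1ℤ) ^ k * Products.fact p p-prime h p≡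
    root = Cases.DoubleRoot.α≈±fact p p-prime h p≡ A D≈0
    k : ℕ
    k = proj₁ root
    α≈±halfFact : A * inv2 p ≈ₚ (- 1ℤ) ^ k * halfFact p
    α≈±halfFact = ≈-trans (proj₂ (proj₂ root))
      (*-cong (≈-refl {(- 1ℤ) ^ k}) (≈-sym (Products.halfFact≈fact p p-prime h p≡)))
    mod1 : p % 8 ≡ 1 → T p A ≡ ((- 1ℤ) ^ ((p ℕ.+ 7) / 8)) * halfFact p [mod p ]
    mod1 p% = ≈⇒∣ (≡.subst (λ n → T p A ≈ₚ (- 1ℤ) ^ n * halfFact p) (≡.sym (exact-+ p% 7 ≡.refl))
      (Cases.DoubleRoot.T-even p p-prime h p≡ A D≈0 (p / 8) (m≡-mod1 m m+m≡h p%)))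
    mod5 : p % 8 ≡ 5 → T p A ≡ (- 1ℤ) ^ (k ℕ.+ (p ∸ 5) / 8) [mod p ]
    mod5 p% = ≈⇒∣ (≡.subst (λ n → T p A ≈ₚ (- 1ℤ) ^ (k ℕ.+ n)) (≡.sym (exact-∸ p%))
      (Cases.DoubleRoot.T-odd p p-prime h p≡ A D≈0 (p / 8) k (m≡-mod5 m m+m≡h p%) (proj₂ (proj₂ root))))

  residue-case : (legendre (A * A + + 4) p ≡ 1ℤ) →
    ((p % 4 ≡ 1) → T p A ≡ - ((A * A + + 4) ^ ((p ∸ 1) / 4)) [mod p ]) ×
    ((p % 4 ≡ 3) → T p A ≡ - ((A * A + + 4) ^ ((p ℕ.+ 1) / 4)) * u ((p ∸ 1) / 2) A * inv2 p [mod p ])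
  residue-case e = mod1 , mod3
    where
    root : ∃ λ x → x * x ≈ₚ A * A + + 4
    root = proj₂ (Legendre.residue p p-prime e)
    mod1 : p % 4 ≡ 1 → T p A ≡ - ((A * A + + 4) ^ ((p ∸ 1) / 4)) [mod p ]
    mod1 p% = ≈⇒∣ (≡.subst (λ n → T p A ≈ₚ - ((A * A + + 4) ^ n)) (≡.sym (exact-∸ p%))
      (Cases.Residue.T-even p p-prime h p≡ A (proj₁ root) (proj₂ root) (proj₁ (Legendre.residue p p-prime e)) (p / 4) (h≡-mod1 p%)))
    mod3 : p % 4 ≡ 3 → T p A ≡ - ((A * A + + 4) ^ ((p ℕ.+ 1) / 4)) * u ((p ∸ 1) / 2) A * inv2 p [mod p ]
    mod3 p% = ≈⇒∣ (≡.subst₂ (λ n k → T p A ≈ₚ - ((A * A + + 4) ^ n) * u k A * inv2 p)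
      (≡.sym (exact-+ p% 1 ≡.refl)) (≡.sym half-pred)
      (Cases.Residue.T-odd p p-prime h p≡ A (proj₁ root) (proj₂ root) (proj₁ (Legendre.residue p p-prime e)) (p / 4) (h≡-mod3 p%)))

  nonresidue-case : (legendre (A * A + + 4) p ≡ - 1ℤ) →
    ((p % 4 ≡ 1) → T p A ≡ (- (A * A) ℤ.- + 4) ^ ((p ∸ 1) / 4) [mod p ]) ×
    ((p % 4 ≡ 3) → T p A ≡ ((- (A * A) ℤ.- + 4) ^ ((p ℕ.+ 1) / 4)) * u ((p ℕ.+ 1) / 2) A * inv2 p [mod p ])
  nonresidue-case e = mod1 , mod3
    where
    mod1 : p % 4 ≡ 1 → T p A ≡ (- (A * A) ℤ.- + 4) ^ ((p ∸ 1) / 4) [mod p ]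
    mod1 p% = ≈⇒∣ (≡.subst (λ n → T p A ≈ₚ (- (A * A) ℤ.- + 4) ^ n) (≡.sym (exact-∸ p%))
      (NonresidueCase.T-even p p-prime h p≡ A (Legendre.nonresidue p p-prime e) (p / 4) (h≡-mod1 p%)))
    mod3 : p % 4 ≡ 3 → T p A ≡ ((- (A * A) ℤ.- + 4) ^ ((p ℕ.+ 1) / 4)) * u ((p ℕ.+ 1) / 2) A * inv2 p [mod p ]
    mod3 p% = ≈⇒∣ (≡.subst₂ (λ n k → T p A ≈ₚ (- (A * A) ℤ.- + 4) ^ n * u k A * inv2 p)
      (≡.sym (exact-+ p% 1 ≡.refl)) (≡.sym half-suc)
      (NonresidueCase.T-odd p p-prime h p≡ A (Legendre.nonresidue p p-prime e) (p / 4) (h≡-mod3 p%)))
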